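{- Let $G$ be a finite simple graph on $n$ vertices with clique number $\omega$, and suppose $G$ is $(4K_1,\overline{P_3\cup P_2})$-free, i.e. $G$ contains no induced subgraph isomorphic to $4K_1$ and none isomorphic to the complement of $P_3\cup P_2$. Then $n\le 7\omega$ and $\chi(G)\le 4\omega$.
   Context: $4K_1$ is the edgeless graph on $4$ vertices; $P_n$ is the path on $n$ vertices; $H_1\cup H_2$ is the disjoint union; $\overline{H}$ is the complement of $H$. $\chi(G)$ is the chromatic number and $\omega$ the size of a largest clique of $G$. -}

module Defs where

open import Data.Empty using (⊥; ⊥-elim)
open import Data.Fin using (Fin; toℕ; splitAt; finToFun; funToFin)
open import Data.Fin.Properties using (_≟_; all?; any?; finToFun-funToFin)
open import Data.Fin.Subset using (Subset; _∈_; ∣_∣)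
open import Data.Fin.Subset.Properties using (_∈?_; anySubset?; ∣p∣≤n; ∣⊥∣≡0; ∉⊥)
open import Data.Nat using (ℕ; zero; suc; _+_; _^_; _≤_; z≤n; s≤s)
import Data.Nat.Properties as ℕ
open import Data.Product using (∃; ∃-syntax; _×_; _,_; proj₁; proj₂)
open import Data.Sum using (_⊎_; inj₁; inj₂; swap)
open import Data.Sum.Relation.Binary.Pointwise using (Pointwise; ⊎-symmetric; ⊎-decidable)
open import Function.Bundles using (_⇔_)
open import Function.Definitions using (Injective)
open import Level using (0ℓ)
open import Relation.Binary.Core using (Rel)
import Relation.Binary.Definitions as Rel
open import Relation.Binary.PropositionalEquality using (_≡_; _≢_; refl; sym; trans)
open import Relation.Nullary using (¬_; Dec; yes; no)
open import Relation.Nullary.Decidable using (map′; ¬?; _×-dec_; _⊎-dec_; _→-dec_)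
import Relation.Unary as Pred

-- A finite simple graph on n vertices.  Decidability of adjacency holds for
-- every finite graph classically; it is a field because Agda is constructive.
record Graph (n : ℕ) : Set₁ where
  field
    Adj    : Rel (Fin n) 0ℓ
    symm   : Rel.Symmetric {A = Fin n} Adj
    irrefl : ∀ i → ¬ Adj i i
    adj?   : Rel.Decidable Adj

open Graph public

private
  variable
    m n : ℕ

edgeless : ∀ n → Graph n
edgeless n .Adj _ _ = ⊥
edgeless n .symm ()
edgeless n .irrefl _ ()
edgeless n .adj? _ _ = no λ ()

path : ∀ n → Graph n
path n .Adj i j = suc (toℕ i) ≡ toℕ j ⊎ suc (toℕ j) ≡ toℕ i
path n .symm = swap
path n .irrefl i (inj₁ eq) = ℕ.1+n≢n eq
path n .irrefl i (inj₂ eq) = ℕ.1+n≢n eq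
path n .adj? i j = (suc (toℕ i) ℕ.≟ toℕ j) ⊎-dec (suc (toℕ j) ℕ.≟ toℕ i)

complement : Graph n → Graph n
complement G .Adj i j = i ≢ j × ¬ Adj G i j
complement G .symm (i≢j , ¬ij) = (λ j≡i → i≢j (sym j≡i)) , λ ji → ¬ij (symm G ji)
complement G .irrefl i (i≢i , _) = i≢i refl
complement G .adj? i j = ¬? (i ≟ j) ×-dec ¬? (adj? G i j)

infixr 5 _∪ᴳ_

-- The first m vertices carry G and the last n carry H.
_∪ᴳ_ : Graph m → Graph n → Graph (m + n)
_∪ᴳ_ {m} G H .Adj i j = Pointwise (Adj G) (Adj H) (splitAt m i) (splitAt m j)
(G ∪ᴳ H) .symm = ⊎-symmetric (symm G) (symm H)
_∪ᴳ_ {m} G H .irrefl i = go (splitAt m i)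
  where
  go : ∀ s → ¬ Pointwise (Adj G) (Adj H) s s
  go (inj₁ a) (Pointwise.inj₁ aa) = irrefl G a aa
  go (inj₂ b) (Pointwise.inj₂ bb) = irrefl H b bb
_∪ᴳ_ {m} G H .adj? i j = ⊎-decidable (adj? G) (adj? H) (splitAt m i) (splitAt m j)

ContainsInduced : Graph n → Graph m → Set
ContainsInduced {n} {m} G H =
  ∃[ f ] Injective {A = Fin m} {B = Fin n} _≡_ _≡_ f
       × (∀ i j → Adj H i j ⇔ Adj G (f i) (f j))

infix 4 _IsFreeOf_

_IsFreeOf_ : Graph n → Graph m → Set
G IsFreeOf H = ¬ ContainsInduced G H

IsClique : Graph n → Subset n → Set
IsClique G S = ∀ i j → i ∈ S → j ∈ S → i ≢ j → Adj G i j

HasCliqueOfSize : Graph n → ℕ → Set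
HasCliqueOfSize G k = ∃[ S ] IsClique G S × ∣ S ∣ ≡ k

IsColouring : ∀ {k} → Graph n → (Fin n → Fin k) → Set
IsColouring G c = ∀ i j → Adj G i j → c i ≢ c j

Colourable : Graph n → ℕ → Set
Colourable {n} G k = ∃[ c ] IsColouring {n} {k} G c

IsGreatest IsLeast : (ℕ → Set) → ℕ → Set
IsGreatest P k = P k × (∀ j → P j → j ≤ k)
IsLeast    P k = P k × (∀ j → P j → k ≤ j)

greatest : {P : ℕ → Set} → Pred.Decidable P → P 0 →
           ∀ b → (∀ j → P j → j ≤ b) → ∃ (IsGreatest P)
greatest P? P0 zero bound = 0 , P0 , bound
greatest {P} P? P0 (suc b) bound with P? (suc b)
... | yes Pb = suc b , Pb , bound
... | no ¬Pb = greatest P? P0 b bound′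
  where
  bound′ : ∀ j → P j → j ≤ b
  bound′ j Pj with ℕ.m≤n⇒m<n∨m≡n (bound j Pj)
  ... | inj₁ (s≤s j≤b) = j≤b
  ... | inj₂ refl = ⊥-elim (¬Pb Pj)

least : {P : ℕ → Set} → Pred.Decidable P → ∀ b → P b → ∃ (IsLeast P)
least {P} P? b Pb with P? 0
... | yes P0 = 0 , P0 , λ _ _ → z≤n
least {P} P? zero    Pb | no ¬P0 = ⊥-elim (¬P0 Pb)
least {P} P? (suc b) Pb | no ¬P0
  with least {λ k → P (suc k)} (λ k → P? (suc k)) b Pb
... | k , Pk , min = suc k , Pk , min′
  where
  min′ : ∀ j → P j → suc k ≤ j
  min′ zero    P0 = ⊥-elim (¬P0 P0)
  min′ (suc j) Pj = s≤s (min j Pj)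

isClique? : (G : Graph n) → Pred.Decidable (IsClique G)
isClique? G S = all? λ i → all? λ j →
  (i ∈? S) →-dec ((j ∈? S) →-dec (¬? (i ≟ j) →-dec adj? G i j))

hasCliqueOfSize? : (G : Graph n) → Pred.Decidable (HasCliqueOfSize G)
hasCliqueOfSize? G k = anySubset? λ S → isClique? G S ×-dec (∣ S ∣ ℕ.≟ k)

isColouring? : ∀ {k} (G : Graph n) → Pred.Decidable (IsColouring {n} {k} G)
isColouring? G c = all? λ i → all? λ j → adj? G i j →-dec ¬? (c i ≟ c j)

-- Functions Fin n → Fin k are enumerated through their codes in Fin (k ^ n).
colourable? : (G : Graph n) → Pred.Decidable (Colourable G)
colourable? {n} G k =
  map′ (λ { (x , p) → finToFun x , p })
       (λ { (c , p) → funToFin c , λ i j ij eq → p i j ij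
              (trans (sym (finToFun-funToFin c i)) (trans eq (finToFun-funToFin c j))) })
       (any? {n = k ^ n} λ x → isColouring? {n} {k} G (finToFun x))

greatestClique : (G : Graph n) → ∃ (IsGreatest (HasCliqueOfSize G))
greatestClique {n} G = greatest (hasCliqueOfSize? G)
  (_ , (λ _ _ i∈⊥ → ⊥-elim (∉⊥ i∈⊥)) , ∣⊥∣≡0 n) n
  λ { _ (S , _ , refl) → ∣p∣≤n S }

leastColouring : (G : Graph n) → ∃ (IsLeast (Colourable G))
leastColouring {n} G = least (colourable? G) n
  ((λ i → i) , λ { i _ ii refl → irrefl G i ii })

ω : Graph n → ℕ
ω G = proj₁ (greatestClique G)

χ : Graph n → ℕ
χ G = proj₁ (leastColouring G)

ω-isGreatest : (G : Graph n) → IsGreatest (HasCliqueOfSize G) (ω G)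
ω-isGreatest G = proj₂ (greatestClique G)

χ-isLeast : (G : Graph n) → IsLeast (Colourable G) (χ G)
χ-isLeast G = proj₂ (leastColouring G)

{-# OPTIONS --safe #-}
-- Write u ≁ v for distinct non-adjacent vertices; the hypotheses exclude K₄ and
-- P₃ ∪ P₂ as induced subgraphs of the graph of ≁.  Let a, b, c be a stable
-- triple, T its common neighbours, N a the vertices adjacent to a only, and D a
-- those non-adjacent to a only.  Each N a ∪ {a} is a clique.
--
-- If T contains a non-adjacent pair, then every D is non-adjacent to it, so the
-- three D together form a clique and ≁ is transitive on T, and the bounds follow.
-- Otherwise ≁ is a matching on each D and on the common neighbours D b ∪ T of a
-- and c.  Removing one vertex from each matched pair makes N a ∪ D c and N c ∪ D a
-- unions of two cliques, which König's theorem colours optimally.  With the class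
-- {a, b, c} and the cliques N b and a transversal of D b ∪ T this gives 4ω − 3
-- colours, to which the colours for the removed vertices must be added.
--
-- Taking T maximal controls their number: a vertex of D a non-adjacent to both
-- ends of a pair in D c must be non-adjacent to some vertex of T.  Hence every end
-- of a pair in D c is non-adjacent to exactly one end of each pair in D a, and
-- two such 0-1 patterns, for adjacent ends, differ in at most two places.  So if two of
-- the three D contain at least two pairs, all contain at most four, and in the
-- extremal cases large cliques through T make up for the removed vertices.

module Submission where

open import Defs
open import Data.Bool using (Bool; true; false; _∧_; _∨_) renaming (T to So)
open import Data.Bool.Properties using (T-∧; T-∨) renaming (T? to So?)
open import Data.Empty using (⊥; ⊥-elim)
open import Data.Fin using (Fin; toℕ; inject≤; splitAt; join) renaming (_<_ to _<ᶠ_)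
open import Data.Fin.Patterns using (0F; 1F; 2F; 3F)
open import Data.Fin.Properties using (_≟_; any?; injective⇒≤; inject≤-injective; join-splitAt)
  renaming (_<?_ to _<ᶠ?_; <-cmp to <ᶠ-cmp; <-asym to <ᶠ-asym)
open import Data.Fin.Subset using (Subset; ⁅_⁆; _∪_; ∣_∣) renaming (⊥ to ∅; _∈_ to _∈ˢ_)
open import Data.Fin.Subset.Properties
  using (p⊂q⇒∣p∣<∣q∣; p⊆p∪q; q⊆p∪q; x∈p∪q⁻; x∈⁅x⁆; x∈⁅y⁆⇒x≡y; ∉⊥)
open import Data.List using (List; []; _∷_; _++_; map; filter; length; allFin; foldr; lookup; cartesianProduct)
open import Data.List.Properties using (length-++; length-map; length-filter; filter-all)
open import Data.List.Membership.Propositional using (_∈_; _∉_; find; lose)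
open import Data.List.Membership.Propositional.Properties
  using (∈-filter⁺; ∈-filter⁻; ∈-allFin; ∈-cartesianProduct⁺; ∈-lookup; ∈-++⁺ˡ; ∈-++⁺ʳ; ∈-map⁺; ∈-map⁻)
open import Data.List.Relation.Unary.All as All using (All; []; _∷_)
import Data.List.Relation.Unary.All.Properties as All
open import Data.List.Relation.Unary.AllPairs as AllPairs using (AllPairs; []; _∷_)
import Data.List.Relation.Unary.AllPairs.Properties as AllPairs
open import Data.List.Relation.Unary.Any as Any using (Any; here; there; index)
import Data.List.Relation.Unary.Any.Properties as Any
open import Data.List.Relation.Unary.Unique.Propositional using (Unique)
import Data.List.Relation.Unary.Unique.Propositional.Properties as Unique
open import Data.List.Relation.Binary.Pointwise as Pointwise using (Pointwise; []; _∷_)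
open import Data.Nat using (ℕ; zero; suc; pred; _+_; _*_; _≤_; _<_; z≤n; s≤s; _≤?_)
open import Data.Nat.Properties
  using (≤-trans; ≤-refl; ≤-reflexive; ≤-pred; pred-mono-≤; ≰⇒>; <⇒≱; ≮⇒≥; n≤1+n; m≤n⇒m≤1+n; m≤m+n; m≤n+m;
    +-mono-≤; +-monoʳ-≤; +-monoˡ-≤; +-suc; +-comm; +-assoc; +-cancelˡ-≤)
open import Data.Nat.Tactic.RingSolver using (solve-∀)
open import Data.Product using (Σ; ∃; ∃-syntax; _×_; _,_; proj₁; proj₂)
open import Data.Sum using (_⊎_; inj₁; inj₂; [_,_]′)
import Data.Sum.Relation.Binary.Pointwise as ⊎ᴾ
open import Data.Unit using (⊤; tt)
open import Function using (_∘_; id)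
open import Function.Bundles using (Equivalence; mk⇔)
open import Relation.Binary.Definitions using (tri<; tri≈; tri>)
open import Relation.Binary.PropositionalEquality using (_≡_; _≢_; refl; sym; trans; cong; cong₂; subst; subst₂)
open import Relation.Nullary using (¬_; Dec; yes; no; does)
open import Relation.Nullary.Decidable using (map′; ¬?; _×-dec_; _⊎-dec_; decidable-stable)
open import Relation.Unary using (Decidable)

open Equivalence using (to; from)

-- Pairwise relations on lists and counting with filters.

allPairs-from-unique : ∀ {A : Set} {R : A → A → Set} {xs} → Unique xs →
  (∀ {x y} → x ∈ xs → y ∈ xs → x ≢ y → R x y) → AllPairs R xs
allPairs-from-unique []          f = []
allPairs-from-unique (x∉ ∷ uniq) f =
  All.tabulate (λ y∈ → f (here refl) (there y∈) (All.lookup x∉ y∈))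
  ∷ allPairs-from-unique uniq (λ x∈ y∈ → f (there x∈) (there y∈))

allPairs-lookup : ∀ {A : Set} {R : A → A → Set} {xs x y} → (∀ {x y} → R x y → R y x) →
  AllPairs R xs → x ∈ xs → y ∈ xs → x ≢ y → R x y
allPairs-lookup R-sym (_ ∷ _)  (here refl) (here refl) x≢y = ⊥-elim (x≢y refl)
allPairs-lookup R-sym (rs ∷ _) (here refl) (there y∈)  _   = All.lookup rs y∈
allPairs-lookup R-sym (rs ∷ _) (there x∈)  (here refl) _   = R-sym (All.lookup rs x∈)
allPairs-lookup R-sym (_ ∷ ap) (there x∈)  (there y∈)  x≢y = allPairs-lookup R-sym ap x∈ y∈ x≢y

module _ {A : Set} where

  # : (A → Bool) → List A → ℕ
  # p xs = length (filter (So? ∘ p) xs)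

  #-modular : ∀ p q xs → # (λ v → p v ∨ q v) xs + # (λ v → p v ∧ q v) xs ≡ # p xs + # q xs
  #-modular p q [] = refl
  #-modular p q (x ∷ xs) with ih ← #-modular p q xs | p x | q x
  ... | true  | true  = trans (cong suc (+-suc _ _)) (trans (cong (suc ∘ suc) ih) (sym (cong suc (+-suc _ _))))
  ... | true  | false = cong suc ih
  ... | false | true  = trans (cong suc ih) (sym (+-suc _ _))
  ... | false | false = ih

  #-mono : ∀ p q xs → (∀ v → So (p v) → So (q v)) → # p xs ≤ # q xs
  #-mono p q [] p⊆q = z≤n
  #-mono p q (x ∷ xs) p⊆q with ih ← #-mono p q xs p⊆q | p x | q x | p⊆q x
  ... | true  | true  | _ = s≤s ih
  ... | true  | false | f = ⊥-elim (f tt)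
  ... | false | true  | _ = m≤n⇒m≤1+n ih
  ... | false | false | _ = ih

  #-filter : ∀ {P : A → Set} (P? : Decidable P) p xs → # p (filter P? xs) ≤ # (λ v → p v ∧ does (P? v)) xs
  #-filter P? p [] = z≤n
  #-filter P? p (x ∷ xs) with ih ← #-filter P? p xs | does (P? x)
  ... | false with p x
  ...   | true  = ih
  ...   | false = ih
  #-filter P? p (x ∷ xs) | true with p x
  ...   | true  = s≤s ih
  ...   | false = ih

  length-filter-< : ∀ {P Q : A → Set} (P? : Decidable P) (Q? : Decidable Q) {s} xs →
    (∀ {v} → P v → Q v) → s ∈ xs → ¬ P s → Q s → length (filter P? xs) < length (filter Q? xs)
  length-filter-< {P} {Q} P? Q? xs P⊆Q s∈ ¬Ps Qs = go xs s∈
    where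
    weak : ∀ xs → length (filter P? xs) ≤ length (filter Q? xs)
    weak [] = z≤n
    weak (x ∷ xs) with P? x | Q? x
    ... | yes _ | yes _ = s≤s (weak xs)
    ... | yes p | no ¬q = ⊥-elim (¬q (P⊆Q p))
    ... | no _  | yes _ = m≤n⇒m≤1+n (weak xs)
    ... | no _  | no _  = weak xs
    go : ∀ xs → _ ∈ xs → length (filter P? xs) < length (filter Q? xs)
    go (x ∷ xs) s∈ with P? x | Q? x | s∈
    ... | yes p | _     | here refl = ⊥-elim (¬Ps p)
    ... | no _  | no ¬q | here refl = ⊥-elim (¬q Qs)
    ... | no _  | yes _ | here refl = s≤s (weak xs)
    ... | yes _ | yes _ | there s∈′ = s≤s (go xs s∈′)
    ... | yes p | no ¬q | there _   = ⊥-elim (¬q (P⊆Q p))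
    ... | no _  | yes _ | there s∈′ = m≤n⇒m≤1+n (go xs s∈′)
    ... | no _  | no _  | there s∈′ = go xs s∈′

  length-filter-⊎ : ∀ {P Q : A → Set} (P? : Decidable P) (Q? : Decidable Q) xs →
    (∀ {v} → v ∈ xs → P v ⊎ Q v) → length xs ≤ length (filter P? xs) + length (filter Q? xs)
  length-filter-⊎ P? Q? [] _ = z≤n
  length-filter-⊎ P? Q? (x ∷ xs) P⊎Q with ih ← length-filter-⊎ P? Q? xs (P⊎Q ∘ there) | P? x | Q? x | P⊎Q (here refl)
  ... | yes _ | yes _ | _       = s≤s (≤-trans ih (+-monoʳ-≤ (length (filter P? xs)) (n≤1+n _)))
  ... | yes _ | no _  | _       = s≤s ih
  ... | no _  | yes _ | _       = ≤-trans (s≤s ih) (≤-reflexive (sym (+-suc _ _)))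
  ... | no ¬p | no _  | inj₁ p  = ⊥-elim (¬p p)
  ... | no _  | no ¬q | inj₂ q  = ⊥-elim (¬q q)

-- Cliques, covers by stable sets, and listings of vertices.

module Graphs {n : ℕ} (G : Graph n) where

  V : Set
  V = Fin n

  infix 4 _~_ _≁_

  _~_ : V → V → Set
  u ~ v = Adj G u v

  _≁_ : V → V → Set
  u ≁ v = Adj (complement G) u v

  _~?_ : ∀ u v → Dec (u ~ v)
  _~?_ = adj? G

  _≁?_ : ∀ u v → Dec (u ≁ v)
  _≁?_ = adj? (complement G)

  ~-sym : ∀ {u v} → u ~ v → v ~ u
  ~-sym = symm G

  ≁-sym : ∀ {u v} → u ≁ v → v ≁ u
  ≁-sym {u} {v} = symm (complement G) {u} {v}

  ~⇒≢ : ∀ {u v} → u ~ v → u ≢ v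
  ~⇒≢ {u} u~u refl = irrefl G u u~u

  ≁⇒¬~ : ∀ {u v} → u ≁ v → ¬ u ~ v
  ≁⇒¬~ = proj₂

  separated : ∀ {u v w} → u ~ w → v ≁ w → u ≢ v
  separated u~w (_ , ¬v~w) refl = ¬v~w u~w

  ≢⇒~⊎≁ : ∀ {u v} → u ≢ v → u ~ v ⊎ u ≁ v
  ≢⇒~⊎≁ {u} {v} u≢v with u ~? v
  ... | yes u~v = inj₁ u~v
  ... | no ¬u~v = inj₂ (u≢v , ¬u~v)

  ¬≁⇒~ : ∀ {u v} → u ≢ v → ¬ u ≁ v → u ~ v
  ¬≁⇒~ u≢v ¬u≁v with ≢⇒~⊎≁ u≢v
  ... | inj₁ u~v = u~v
  ... | inj₂ u≁v = ⊥-elim (¬u≁v u≁v)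

  -- The induced subgraphs excluded here are those of the complement.
  K₄-Free : Set
  K₄-Free = ∀ {a b c d} → a ≁ b → a ≁ c → a ≁ d → b ≁ c → b ≁ d → c ≁ d → ⊥

  P₃∪P₂-Free : Set
  P₃∪P₂-Free = ∀ {u v x y z} → u ≁ v → x ≁ y → y ≁ z → x ~ z →
    u ~ x × u ~ y × u ~ z → v ~ x × v ~ y × v ~ z → ⊥

  listOf : ∀ {P : V → Set} → Decidable P → List V
  listOf P? = filter P? (allFin n)

  ∈-listOf⁺ : ∀ {P : V → Set} (P? : Decidable P) {v} → P v → v ∈ listOf P?
  ∈-listOf⁺ P? {v} = ∈-filter⁺ P? (∈-allFin v)

  ∈-listOf⁻ : ∀ {P : V → Set} (P? : Decidable P) {v} → v ∈ listOf P? → P v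
  ∈-listOf⁻ P? v∈ = proj₂ (∈-filter⁻ P? {xs = allFin n} v∈)

  Clique : List V → Set
  Clique = AllPairs _~_

  listOf-clique : ∀ {P : V → Set} (P? : Decidable P) →
    (∀ {u v} → P u → P v → u ≢ v → u ~ v) → Clique (listOf P?)
  listOf-clique P? adjacent = allPairs-from-unique (Unique.filter⁺ P? (Unique.allFin⁺ n))
    λ u∈ v∈ → adjacent (∈-listOf⁻ P? u∈) (∈-listOf⁻ P? v∈)

  toSubset : List V → Subset n
  toSubset = foldr (λ x S → ⁅ x ⁆ ∪ S) ∅

  ∈-toSubset⁻ : ∀ xs {v} → v ∈ˢ toSubset xs → v ∈ xs
  ∈-toSubset⁻ []       v∈ = ⊥-elim (∉⊥ v∈)
  ∈-toSubset⁻ (x ∷ xs) v∈ with x∈p∪q⁻ ⁅ x ⁆ (toSubset xs) v∈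
  ... | inj₁ v∈x = here (x∈⁅y⁆⇒x≡y x v∈x)
  ... | inj₂ v∈S = there (∈-toSubset⁻ xs v∈S)

  length≤∣toSubset∣ : ∀ {xs} → Clique xs → length xs ≤ ∣ toSubset xs ∣
  length≤∣toSubset∣ []                = z≤n
  length≤∣toSubset∣ {x ∷ xs} (x~ ∷ c) = ≤-trans (s≤s (length≤∣toSubset∣ c)) (p⊂q⇒∣p∣<∣q∣
    ( q⊆p∪q ⁅ x ⁆ (toSubset xs)
    , x , p⊆p∪q (toSubset xs) (x∈⁅x⁆ x)
    , λ x∈ → irrefl G x (All.lookup x~ (∈-toSubset⁻ xs x∈))))

  clique≤ω : ∀ {xs} → Clique xs → length xs ≤ ω G
  clique≤ω {xs} c = ≤-trans (length≤∣toSubset∣ c)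
    (proj₂ (ω-isGreatest G) _ (toSubset xs , isClique , refl))
    where
    isClique : IsClique G (toSubset xs)
    isClique i j i∈ j∈ = allPairs-lookup ~-sym c (∈-toSubset⁻ xs i∈) (∈-toSubset⁻ xs j∈)

  Stable : List V → Set
  Stable C = ∀ {u v} → u ∈ C → v ∈ C → ¬ u ~ v

  stable-[x] : ∀ {x} → Stable (x ∷ [])
  stable-[x] {x} (here refl) (here refl) = irrefl G x

  stable-[x,y] : ∀ {x y} → x ≁ y → Stable (x ∷ y ∷ [])
  stable-[x,y] {x} x≁y (here refl) (here refl) = irrefl G x
  stable-[x,y] x≁y (here refl) (there (here refl)) = ≁⇒¬~ x≁y
  stable-[x,y] x≁y (there (here refl)) (here refl) = ≁⇒¬~ x≁y ∘ ~-sym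
  stable-[x,y] {_} {y} x≁y (there (here refl)) (there (here refl)) = irrefl G y

  -- A colouring of `X` whose classes may overlap, be empty or leave `X`, so that `_⊕_` and
  -- `Cover-map` need no disjointness. `Cover⇒χ≤` recovers a colouring by picking one covering class
  -- for each vertex.
  record Cover (X : V → Set) (k : ℕ) : Set where
    field
      classes : List (List V)
      stable  : All Stable classes
      covers  : ∀ {v} → X v → Any (v ∈_) classes
      size    : length classes ≤ k

  open Cover public

  Cover-map : ∀ {X Y k l} → (∀ {v} → Y v → X v) → k ≤ l → Cover X k → Cover Y l
  Cover-map Y⊆X k≤l C = record
    { classes = C .classes ; stable = C .stable
    ; covers = C .covers ∘ Y⊆X ; size = ≤-trans (C .size) k≤l }

  infixr 5 _⊕_

  _⊕_ : ∀ {X Y k l} → Cover X k → Cover Y l → Cover (λ v → X v ⊎ Y v) (k + l)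
  C ⊕ D = record
    { classes = C .classes ++ D .classes
    ; stable = All.++⁺ (C .stable) (D .stable)
    ; covers = [ Any.++⁺ˡ ∘ C .covers , Any.++⁺ʳ (C .classes) ∘ D .covers ]′
    ; size = ≤-trans (≤-reflexive (length-++ (C .classes))) (+-mono-≤ (C .size) (D .size)) }

  map-cover : ∀ {A : Set} {X : V → Set} (f : A → List V) (as : List A) →
    All (Stable ∘ f) as → (∀ {v} → X v → Any (λ a → v ∈ f a) as) → Cover X (length as)
  map-cover f as st cov = record
    { classes = map f as ; stable = All.map⁺ st
    ; covers = Any.map⁺ ∘ cov ; size = ≤-reflexive (length-map f as) }

  singletons : ∀ xs → Cover (_∈ xs) (length xs)
  singletons xs = map-cover (λ x → x ∷ []) xs (All.tabulate (λ {x} _ → stable-[x] {x})) (Any.map here)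

  one-class : ∀ C → Stable C → Cover (_∈ C) 1
  one-class C st = record { classes = C ∷ [] ; stable = st ∷ [] ; covers = here ; size = ≤-refl }

  Cover⇒χ≤ : ∀ {k} → Cover (λ _ → ⊤) k → χ G ≤ k
  Cover⇒χ≤ {k} C = proj₂ (χ-isLeast G) k (colour , proper)
    where
    class : V → Fin (length (C .classes))
    class v = index (C .covers {v} tt)
    colour : V → Fin k
    colour v = inject≤ (class v) (C .size)
    proper : IsColouring G colour
    proper i j i~j ci≡cj = All.lookup (C .stable) (∈-lookup (class j))
      (subst (λ c → i ∈ lookup (C .classes) c) (inject≤-injective (C .size) (C .size) _ _ ci≡cj)
        (Any.lookup-index (C .covers {i} tt)))
      (Any.lookup-index (C .covers {j} tt)) i~j

  -- The counterpart of `Cover` for counting vertices: repetitions and vertices outside `X` do no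
  -- harm, since only upper bounds are wanted.
  record Listing (X : V → Set) (k : ℕ) : Set where
    field
      elements : List V
      lists    : ∀ {v} → X v → v ∈ elements
      count    : length elements ≤ k

  open Listing public

  Listing-map : ∀ {X Y k l} → (∀ {v} → Y v → X v) → k ≤ l → Listing X k → Listing Y l
  Listing-map Y⊆X k≤l L = record
    { elements = L .elements ; lists = L .lists ∘ Y⊆X ; count = ≤-trans (L .count) k≤l }

  listing : ∀ xs → Listing (_∈ xs) (length xs)
  listing xs = record { elements = xs ; lists = id ; count = ≤-refl }

  infixr 5 _⊞_

  _⊞_ : ∀ {X Y k l} → Listing X k → Listing Y l → Listing (λ v → X v ⊎ Y v) (k + l)
  L ⊞ M = record
    { elements = L .elements ++ M .elements
    ; lists = [ ∈-++⁺ˡ ∘ L .lists , ∈-++⁺ʳ (L .elements) ∘ M .lists ]′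
    ; count = ≤-trans (≤-reflexive (length-++ (L .elements))) (+-mono-≤ (L .count) (M .count)) }

  Listing⇒n≤ : ∀ {k} → Listing (λ _ → ⊤) k → n ≤ k
  Listing⇒n≤ L = ≤-trans (injective⇒≤ {f = position} injective) (L .count)
    where
    position : V → Fin (length (L .elements))
    position v = index (L .lists {v} tt)
    injective : ∀ {u v} → position u ≡ position v → u ≡ v
    injective {u} {v} eq = trans (Any.lookup-index (L .lists {u} tt))
      (trans (cong (lookup (L .elements)) eq) (sym (Any.lookup-index (L .lists {v} tt))))

  -- König's theorem for the bipartite non-adjacency graph between X and Y.

  Independent : List V → List V → (V → Bool) → (V → Bool) → Set
  Independent X Y p q = ∀ {x y} → x ∈ X → y ∈ Y → So (p x) → So (q y) → ¬ x ≁ y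

  -- Boolean predicates make meets and joins pointwise, and the same predicate can be counted on a
  -- longer or a shorter list.
  record BigIndependent (X Y : List V) (k : ℕ) : Set where
    field
      left right : V → Bool
      indep : Independent X Y left right
      big   : k ≤ # left X + # right Y

  open BigIndependent

  does⇒ : ∀ {P : Set} (d : Dec P) → So (does d) → P
  does⇒ (yes p) _ = p

  ⇒does : ∀ {P : Set} (d : Dec P) → P → So (does d)
  ⇒does (yes _) _ = tt
  ⇒does (no ¬p) p = ⊥-elim (¬p p)

  #-∷ : ∀ (p : V → Bool) x xs → So (p x) → suc (# p xs) ≤ # p (x ∷ xs)
  #-∷ p x xs px with p x
  ... | true = ≤-refl

  #-all : ∀ (p : V → Bool) xs → (∀ v → So (p v)) → # p xs ≡ length xs
  #-all p xs all = cong (length {A = V}) {y = xs} (filter-all (So? ∘ p) (All.tabulate (λ {v} _ → all v)))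

  without : V → List V → List V
  without y = filter (λ v → ¬? (v ≟ y))

  ∈-without : ∀ {y v} Y → v ∈ Y → v ≢ y → v ∈ without y Y
  ∈-without {y} Y = ∈-filter⁺ (λ v → ¬? (v ≟ y))

  covers-edge : ∀ {x y X Y k} → x ≁ y → Cover (λ v → v ∈ X ⊎ v ∈ without y Y) k →
                Cover (λ v → v ∈ x ∷ X ⊎ v ∈ Y) (suc k)
  covers-edge {x} {y} {X} {Y} x≁y C = Cover-map split ≤-refl (one-class (x ∷ y ∷ []) (stable-[x,y] x≁y) ⊕ C)
    where
    split : ∀ {v} → v ∈ x ∷ X ⊎ v ∈ Y → v ∈ x ∷ y ∷ [] ⊎ (v ∈ X ⊎ v ∈ without y Y)
    split (inj₁ (here v≡x)) = inj₁ (here v≡x)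
    split (inj₁ (there v∈)) = inj₂ (inj₁ v∈)
    split {v} (inj₂ v∈) with v ≟ y
    ... | yes v≡y = inj₁ (there (here v≡y))
    ... | no  v≢y = inj₂ (inj₂ (∈-without Y v∈ v≢y))

  -- Switching `x` off on the left makes independence vacuous at the new vertex; as `x` does not
  -- occur in `X`, the count does not drop.
  extendˡ : ∀ {x X Y k} → All (x ≢_) X → BigIndependent X Y k → BigIndependent (x ∷ X) Y k
  extendˡ {x} {X} {Y} x∉X I = record
    { left = left′ ; right = I .right ; indep = indep′
    ; big = ≤-trans (I .big) (+-monoˡ-≤ (# (I .right) Y) (≤-trans
        (subst (λ xs → # (I .left) xs ≤ # left′ X) (filter-all v≢x? (All.map (λ x≢v v≡x → x≢v (sym v≡x)) x∉X))
          (#-filter v≢x? (I .left) X))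
        #left′-∷)) }
    where
    v≢x? : Decidable (_≢ x)
    v≢x? v = ¬? (v ≟ x)
    left′ : V → Bool
    left′ v = I .left v ∧ does (v≢x? v)
    #left′-∷ : # left′ X ≤ # left′ (x ∷ X)
    #left′-∷ with left′ x
    ... | true  = n≤1+n _
    ... | false = ≤-refl
    indep′ : Independent (x ∷ X) Y left′ (I .right)
    indep′ (here refl) y∈ lx ry = λ _ → does⇒ (v≢x? x) (proj₂ (to T-∧ lx)) refl
    indep′ (there u∈)  y∈ lu ry = I .indep u∈ y∈ (proj₁ (to T-∧ lu)) ry

  -- Switching `y` off on the right costs nothing, since it was not counted in `without y Y`.
  extendʳ : ∀ {X Y k} y → BigIndependent X (without y Y) k →
            Σ (BigIndependent X Y k) λ J → ¬ So (J .right y)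
  extendʳ {X} {Y} y I = record
    { left = I .left ; right = right′ ; indep = indep′
    ; big = ≤-trans (I .big) (+-monoʳ-≤ (# (I .left) X) (#-filter v≢y? (I .right) Y)) }
    , λ ry → does⇒ (v≢y? y) (proj₂ (to (T-∧ {x = I .right y}) ry)) refl
    where
    v≢y? : Decidable (_≢ y)
    v≢y? v = ¬? (v ≟ y)
    right′ : V → Bool
    right′ v = I .right v ∧ does (v≢y? v)
    indep′ : Independent X Y (I .left) right′
    indep′ x∈ y∈ lx ry = I .indep x∈
      (∈-without Y y∈ (does⇒ (v≢y? _) (proj₂ (to T-∧ ry)))) lx (proj₁ (to T-∧ ry))

  -- By modularity of the size, if the meet of two independent sets of more
  -- than k elements has at most k + 1, then the join has more than k.
  meet-or-join : ∀ {X Y k} (I J : BigIndependent X Y (suc k)) → BigIndependent X Y (2 + k) ⊎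
    Σ (BigIndependent X Y (suc k)) λ K → ∀ {v} → So (K .right v) → So (I .right v) × So (J .right v)
  meet-or-join {X} {Y} {k} I J = decide (2 + k ≤? # meetˡ X + # joinʳ Y)
    where
    joinˡ meetˡ joinʳ meetʳ : V → Bool
    joinˡ v = I .left v ∨ J .left v
    meetˡ v = I .left v ∧ J .left v
    joinʳ v = I .right v ∨ J .right v
    meetʳ v = I .right v ∧ J .right v

    meet-indep : Independent X Y meetˡ joinʳ
    meet-indep x∈ y∈ lx ry with to T-∧ lx | to T-∨ ry
    ... | lIx , _ | inj₁ rIy = I .indep x∈ y∈ lIx rIy
    ... | _ , lJx | inj₂ rJy = J .indep x∈ y∈ lJx rJy

    join-indep : Independent X Y joinˡ meetʳ
    join-indep x∈ y∈ lx ry with to T-∨ lx | to T-∧ ry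
    ... | inj₁ lIx | rIy , _ = I .indep x∈ y∈ lIx rIy
    ... | inj₂ lJx | _ , rJy = J .indep x∈ y∈ lJx rJy

    total : (# meetˡ X + # joinʳ Y) + (# joinˡ X + # meetʳ Y) ≡
            (# (I .left) X + # (I .right) Y) + (# (J .left) X + # (J .right) Y)
    total = trans (exchange (# meetˡ X) (# joinʳ Y) (# joinˡ X) (# meetʳ Y))
      (trans (cong₂ _+_ (#-modular (I .left) (J .left) X) (#-modular (I .right) (J .right) Y))
        (exchange′ (# (I .left) X) (# (J .left) X) (# (I .right) Y) (# (J .right) Y)))
      where
      exchange : ∀ a b c d → (a + b) + (c + d) ≡ (c + a) + (b + d)
      exchange = solve-∀
      exchange′ : ∀ a b c d → (a + b) + (c + d) ≡ (a + c) + (b + d)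
      exchange′ = solve-∀

    decide : Dec (2 + k ≤ # meetˡ X + # joinʳ Y) → _
    decide (yes big) = inj₁ record { left = meetˡ ; right = joinʳ ; indep = meet-indep ; big = big }
    decide (no small) = inj₂
      ( record { left = joinˡ ; right = meetʳ ; indep = join-indep ; big = join-big }
      , λ {v} r → to (T-∧ {I .right v}) r )
      where
      join-big : suc k ≤ # joinˡ X + # meetʳ Y
      join-big = +-cancelˡ-≤ (suc k) _ _ (≤-trans
        (≤-trans (+-mono-≤ (I .big) (J .big)) (≤-reflexive (sym total)))
        (+-monoˡ-≤ (# joinˡ X + # meetʳ Y) (≤-pred (≰⇒> small))))

  -- Induction on the first list. If the tail `X` and `Y` have a cover by `k` classes, the class of
  -- `x` alone is added. Otherwise, for each non-neighbour `y` of `x` in `Y`, either `X` and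
  -- `without y Y` have a cover by `k` classes, to which the class of `x` and `y` is added, or some
  -- independent set of more than `k` vertices avoids `y`. `meet-or-join` merges these sets until
  -- one avoids all non-neighbours of `x` and can be enlarged by `x`, unless a merge is already
  -- large enough.
  cover-or-independent : ∀ {X} → Unique X → ∀ Y k →
    BigIndependent X Y (suc k) ⊎ Cover (λ v → v ∈ X ⊎ v ∈ Y) k
  cover-or-independent [] Y k with suc k ≤? length Y
  ... | yes k<Y = inj₁ record
    { left = λ _ → false ; right = λ _ → true ; indep = λ ()
    ; big = subst (suc k ≤_) (sym (#-all (λ _ → true) Y (λ _ → tt))) k<Y }
  ... | no k≮Y = inj₂ (Cover-map (λ { (inj₂ v∈) → v∈ }) (≮⇒≥ k≮Y) (singletons Y))
  cover-or-independent (_ ∷ _) Y zero = inj₁ record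
    { left = λ _ → true ; right = λ _ → false ; indep = λ _ _ _ () ; big = s≤s z≤n }
  cover-or-independent {x ∷ X} (x∉X ∷ uniq) Y (suc k) with cover-or-independent uniq Y k
  ... | inj₂ C = inj₂ (Cover-map
        (λ { (inj₁ (here v≡x)) → inj₁ (here v≡x) ; (inj₁ (there v∈)) → inj₂ (inj₁ v∈) ; (inj₂ v∈) → inj₂ (inj₂ v∈) })
        ≤-refl (singletons (x ∷ []) ⊕ C))
  ... | inj₁ I₀ = [ id , addˡ ]′ (avoiding (filter (x ≁?_) Y) (λ y∈ → proj₂ (∈-filter⁻ (x ≁?_) {xs = Y} y∈)))
    where
    Result : Set
    Result = BigIndependent (x ∷ X) Y (2 + k) ⊎ Cover (λ v → v ∈ x ∷ X ⊎ v ∈ Y) (suc k)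

    Avoiding : List V → Set
    Avoiding N = Σ (BigIndependent X Y (suc k)) λ I → ∀ {v} → v ∈ N → ¬ So (I .right v)

    avoiding : ∀ N → (∀ {y} → y ∈ N → x ≁ y) → Result ⊎ Avoiding N
    avoiding [] _ = inj₂ (I₀ , λ ())
    avoiding (y ∷ N) x≁ with avoiding N (x≁ ∘ there)
    ... | inj₁ result = inj₁ result
    ... | inj₂ (I , I-avoids) with cover-or-independent uniq (without y Y) k
    ...   | inj₂ C = inj₁ (inj₂ (covers-edge (x≁ (here refl)) C))
    ...   | inj₁ J′ with extendʳ y J′
    ...     | J , J-avoids with meet-or-join I J
    ...       | inj₁ big = inj₁ (inj₁ (extendˡ x∉X big))
    ...       | inj₂ (K , K⊆) = inj₂ (K , λ
                  { (here refl) rv → J-avoids (proj₂ (K⊆ rv))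
                  ; (there v∈)  rv → I-avoids v∈ (proj₁ (K⊆ rv)) })

    addˡ : Avoiding (filter (x ≁?_) Y) → Result
    addˡ (I , avoids) = inj₁ record
      { left = left′ ; right = I .right ; indep = indep′
      ; big = ≤-trans (s≤s (I .big)) (+-monoˡ-≤ (# (I .right) Y)
          (≤-trans (s≤s (#-mono (I .left) left′ X (λ _ lv → from T-∨ (inj₁ lv))))
            (#-∷ left′ x X (from (T-∨ {x = I .left x}) (inj₂ (⇒does (x ≟ x) refl)))))) }
      where
      left′ : V → Bool
      left′ v = I .left v ∨ does (v ≟ x)
      indep′ : Independent (x ∷ X) Y left′ (I .right)
      indep′ (here refl) y∈ _ ry x≁y = avoids (∈-filter⁺ (x ≁?_) y∈ x≁y) ry
      indep′ {u} (there u∈) y∈ lu ry u≁y with to (T-∨ {I .left u}) lu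
      ... | inj₁ lu′ = I .indep u∈ y∈ lu′ ry u≁y
      ... | inj₂ u≡x with refl ← does⇒ (u ≟ x) u≡x = avoids (∈-filter⁺ (x ≁?_) y∈ u≁y) ry

  -- An independent set of the non-adjacency graph between two cliques is itself a clique of `G`, so
  -- `bound` rules out the first alternative of `cover-or-independent`.
  two-clique-cover : ∀ {X Y} k → Clique X → Clique Y → (∀ {x y} → x ∈ X → y ∈ Y → x ≢ y) →
    (∀ {Z} → Clique Z → All (λ z → z ∈ X ⊎ z ∈ Y) Z → length Z ≤ k) →
    Cover (λ v → v ∈ X ⊎ v ∈ Y) k
  two-clique-cover {X} {Y} k X-clique Y-clique X≢Y bound
    with cover-or-independent (AllPairs.map ~⇒≢ X-clique) Y k
  ... | inj₂ C = C
  ... | inj₁ I = ⊥-elim (<⇒≱ (≤-trans (I .big) (≤-reflexive (sym (length-++ X′))))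
                  (bound Z-clique (All.++⁺ (All.tabulate (inj₁ ∘ proj₁ ∘ X′⊆)) (All.tabulate (inj₂ ∘ proj₁ ∘ Y′⊆)))))
    where
    X′ = filter (So? ∘ I .left) X
    Y′ = filter (So? ∘ I .right) Y
    X′⊆ : ∀ {v} → v ∈ X′ → v ∈ X × So (I .left v)
    X′⊆ = ∈-filter⁻ (So? ∘ I .left) {xs = X}
    Y′⊆ : ∀ {v} → v ∈ Y′ → v ∈ Y × So (I .right v)
    Y′⊆ = ∈-filter⁻ (So? ∘ I .right) {xs = Y}
    Z-clique : Clique (X′ ++ Y′)
    Z-clique = AllPairs.++⁺ (AllPairs.filter⁺ _ X-clique) (AllPairs.filter⁺ _ Y-clique)
      (All.tabulate λ x∈ → All.tabulate λ y∈ → ¬≁⇒~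
        (X≢Y (proj₁ (X′⊆ x∈)) (proj₁ (Y′⊆ y∈)))
        (I .indep (proj₁ (X′⊆ x∈)) (proj₁ (Y′⊆ y∈)) (proj₂ (X′⊆ x∈)) (proj₂ (Y′⊆ y∈))))

-- Stable triples and the types of vertices around them.

module FreeGraphs {n : ℕ} (G : Graph n) (K₄-free : Graphs.K₄-Free G) (P₃∪P₂-free : Graphs.P₃∪P₂-Free G) where

  open Graphs G

  w : ℕ
  w = ω G

  Goal : Set
  Goal = n ≤ 7 * w × χ G ≤ 4 * w

  -- A stable triple of `G`, named as a triangle of `≁`. The cyclic form makes `rotate` a
  -- permutation of the fields.
  record Triangle (a b c : V) : Set where
    constructor triangle
    field
      ab : a ≁ b
      bc : b ≁ c
      ca : c ≁ a

  rotate : ∀ {a b c} → Triangle a b c → Triangle b c a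
  rotate (triangle ab bc ca) = triangle bc ca ab

  reflect : ∀ {a b c} → Triangle a b c → Triangle a c b
  reflect (triangle ab bc ca) = triangle (≁-sym ca) (≁-sym bc) (≁-sym ab)

  triangle? : ∀ a b c → Dec (Triangle a b c)
  triangle? a b c = map′ (λ { (p , q , r) → triangle p q r }) (λ { (triangle p q r) → p , q , r })
    ((a ≁? b) ×-dec (b ≁? c) ×-dec (c ≁? a))

  N D T : V → V → V → V → Set
  N a b c v = v ~ a × v ≁ b × v ≁ c
  D a b c v = v ≁ a × v ~ b × v ~ c
  T a b c v = v ~ a × v ~ b × v ~ c

  N? : ∀ a b c → Decidable (N a b c)
  N? a b c v = (v ~? a) ×-dec (v ≁? b) ×-dec (v ≁? c)

  D? : ∀ a b c → Decidable (D a b c)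
  D? a b c v = (v ≁? a) ×-dec (v ~? b) ×-dec (v ~? c)

  T? : ∀ a b c → Decidable (T a b c)
  T? a b c v = (v ~? a) ×-dec (v ~? b) ×-dec (v ~? c)

  Ns Ds Ts : V → V → V → List V
  Ns a b c = listOf (N? a b c)
  Ds a b c = listOf (D? a b c)
  Ts a b c = listOf (T? a b c)

  T-rotate : ∀ {a b c v} → T a b c v → T b c a v
  T-rotate (va , vb , vc) = vb , vc , va

  data Position (a b c v : V) : Set where
    corner : v ∈ a ∷ b ∷ c ∷ [] → Position a b c v
    inNa   : N a b c v → Position a b c v
    inNb   : N b c a v → Position a b c v
    inNc   : N c a b v → Position a b c v
    inDa   : D a b c v → Position a b c v
    inDb   : D b c a v → Position a b c v
    inDc   : D c a b v → Position a b c v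
    inT    : T a b c v → Position a b c v

  position : ∀ {a b c} → Triangle a b c → ∀ v → Position a b c v
  position {a} {b} {c} (triangle ab bc ca) v with v ≟ a | v ≟ b | v ≟ c
  ... | yes v≡a | _ | _ = corner (here v≡a)
  ... | _ | yes v≡b | _ = corner (there (here v≡b))
  ... | _ | _ | yes v≡c = corner (there (there (here v≡c)))
  ... | no v≢a | no v≢b | no v≢c with ≢⇒~⊎≁ v≢a | ≢⇒~⊎≁ v≢b | ≢⇒~⊎≁ v≢c
  ... | inj₁ va | inj₁ vb | inj₁ vc = inT (va , vb , vc)
  ... | inj₂ va | inj₁ vb | inj₁ vc = inDa (va , vb , vc)
  ... | inj₁ va | inj₂ vb | inj₁ vc = inDb (vb , vc , va)
  ... | inj₁ va | inj₁ vb | inj₂ vc = inDc (vc , va , vb)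
  ... | inj₁ va | inj₂ vb | inj₂ vc = inNa (va , vb , vc)
  ... | inj₂ va | inj₁ vb | inj₂ vc = inNb (vb , vc , va)
  ... | inj₂ va | inj₂ vb | inj₁ vc = inNc (vc , va , vb)
  ... | inj₂ va | inj₂ vb | inj₂ vc = ⊥-elim (K₄-free va vb vc ab (≁-sym ca) bc)

  N-clique : ∀ {a b c} → Triangle a b c → Clique (Ns a b c)
  N-clique {a} {b} {c} tri = listOf-clique (N? a b c) λ (_ , ub , uc) (_ , vb , vc) u≢v →
    ¬≁⇒~ u≢v λ uv → K₄-free uv ub uc vb vc (Triangle.bc tri)

  cons-clique : ∀ {P : V → Set} (P? : Decidable P) {a} → (∀ {v} → P v → v ~ a) →
                Clique (listOf P?) → Clique (a ∷ listOf P?)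
  cons-clique P? ~a c = All.tabulate (λ v∈ → ~-sym (~a (∈-listOf⁻ P? v∈))) ∷ c

  N-bound : ∀ {a b c} → Triangle a b c → suc (length (Ns a b c)) ≤ w
  N-bound tri = clique≤ω (cons-clique (N? _ _ _) proj₁ (N-clique tri))

  corners-stable : ∀ {a b c} → Triangle a b c → Stable (a ∷ b ∷ c ∷ [])
  corners-stable {a} {b} {c} (triangle ab bc ca) = λ
    { (here refl) → λ { (here refl) → irrefl G a ; (there (here refl)) → ≁⇒¬~ ab ; (there (there (here refl))) → ≁⇒¬~ ca ∘ ~-sym }
    ; (there (here refl)) → λ { (here refl) → ≁⇒¬~ ab ∘ ~-sym ; (there (here refl)) → irrefl G b ; (there (there (here refl))) → ≁⇒¬~ bc }
    ; (there (there (here refl))) → λ { (here refl) → ≁⇒¬~ ca ; (there (here refl)) → ≁⇒¬~ bc ∘ ~-sym ; (there (there (here refl))) → irrefl G c } }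

  maximal-clique : ∀ (xs : List V) → ∃[ R ] Clique R × (∀ {v} → v ∈ R → v ∈ xs) ×
                   (∀ {v} → v ∈ xs → v ∈ R ⊎ Any (v ≁_) R)
  maximal-clique [] = [] , [] , (λ ()) , λ ()
  maximal-clique (x ∷ xs) with maximal-clique xs
  ... | R , R-clique , R⊆ , maximal with Any.any? (λ r → (x ≟ r) ⊎-dec (x ≁? r)) R
  ... | yes blocked = R , R-clique , there ∘ R⊆ , λ
        { (here refl) → [ inj₁ , inj₂ ]′ (Any.Any-⊎⁻ blocked) ; (there v∈) → maximal v∈ }
  ... | no free = x ∷ R
        , All.tabulate (λ {r} r∈ → ¬≁⇒~ (λ x≡r → free (lose r∈ (inj₁ x≡r))) (λ x≁r → free (lose r∈ (inj₂ x≁r)))) ∷ R-clique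
        , (λ { (here eq) → here eq ; (there v∈) → there (R⊆ v∈) })
        , λ { (here eq) → inj₁ (here eq)
            ; (there v∈) → [ inj₁ ∘ there , inj₂ ∘ there ]′ (maximal v∈) }

  -- A stable triple completely joined to a non-adjacent pair.

  module JoinedPair {a b c t t′} (tri : Triangle a b c) (t≁t′ : t ≁ t′) (Tt : T a b c t) (Tt′ : T a b c t′) where

    -- If `x` were adjacent to both `t` and `t′`, these two would be joined to the path `x`, `a`,
    -- `b` of `≁`. If it were adjacent to only one of them, the pair `b`, `c` would be joined to the
    -- path that `x`, `t` and `t′` form in `≁`.
    misses : ∀ {a b c x} → Triangle a b c → T a b c t → T a b c t′ → D a b c x → x ≁ t × x ≁ t′
    misses {a} {b} {c} {x} (triangle ab bc ca) (ta , tb , tc) (t′a , t′b , t′c) (xa , xb , xc)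
      with ≢⇒~⊎≁ (separated ta xa ∘ sym) | ≢⇒~⊎≁ (separated t′a xa ∘ sym)
    ... | inj₂ xt | inj₂ xt′ = xt , xt′
    ... | inj₁ xt | inj₁ xt′ = ⊥-elim
          (P₃∪P₂-free t≁t′ xa ab xb (~-sym xt , ta , tb) (~-sym xt′ , t′a , t′b))
    ... | inj₂ xt | inj₁ xt′ = ⊥-elim
          (P₃∪P₂-free bc xt t≁t′ xt′ (~-sym xb , ~-sym tb , ~-sym t′b) (~-sym xc , ~-sym tc , ~-sym t′c))
    ... | inj₁ xt | inj₂ xt′ = ⊥-elim
          (P₃∪P₂-free bc xt′ (≁-sym t≁t′) xt (~-sym xb , ~-sym t′b , ~-sym tb) (~-sym xc , ~-sym t′c , ~-sym tc))

    D∪ : V → Set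
    D∪ v = D a b c v ⊎ D b c a v ⊎ D c a b v

    D∪? : Decidable D∪
    D∪? v = D? a b c v ⊎-dec D? b c a v ⊎-dec D? c a b v

    D∪-misses : ∀ {x} → D∪ x → x ≁ t × x ≁ t′
    D∪-misses (inj₁ x∈)        = misses tri Tt Tt′ x∈
    D∪-misses (inj₂ (inj₁ x∈)) = misses (rotate tri) (T-rotate Tt) (T-rotate Tt′) x∈
    D∪-misses (inj₂ (inj₂ x∈)) = misses (rotate (rotate tri)) (T-rotate (T-rotate Tt)) (T-rotate (T-rotate Tt′)) x∈

    D∪-clique : Clique (listOf D∪?)
    D∪-clique = listOf-clique D∪? λ x∈ y∈ x≢y → ¬≁⇒~ x≢y λ xy →
      let (xt , xt′) = D∪-misses x∈ ; (yt , yt′) = D∪-misses y∈ in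
      K₄-free xy xt xt′ yt yt′ t≁t′

    -- The pair `a`, `b` is joined to all of `T`, so `≁` has no induced path on three vertices
    -- there. Its components on `T` are therefore stable sets, which serve as colour classes.
    T-transitive : ∀ {x y z} → T a b c x → T a b c y → T a b c z → x ≁ y → y ≁ z → x ≢ z → x ≁ z
    T-transitive (xa , xb , _) (ya , yb , _) (za , zb , _) xy yz x≢z with ≢⇒~⊎≁ x≢z
    ... | inj₂ xz = xz
    ... | inj₁ xz = ⊥-elim (P₃∪P₂-free (Triangle.ab tri) xy yz xz
          (~-sym xa , ~-sym ya , ~-sym za) (~-sym xb , ~-sym yb , ~-sym zb))

    Tᵗ? : Decidable (λ v → T a b c v × v ~ t)
    Tᵗ? v = T? a b c v ×-dec (v ~? t)

    -- If `x ≁ u`, the path `u`, `x`, `t` of `≁` would be joined to the pair `b`, `c`. Hence the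
    -- clique formed by the three D can be extended by any clique of common neighbours adjacent to
    -- `t`.
    D~T : ∀ {a b c x u} → Triangle a b c → T a b c t → T a b c u → u ~ t → D a b c x → x ≁ t → x ~ u
    D~T (triangle ab bc ca) (ta , tb , tc) (ua , ub , uc) ut (xa , xb , xc) xt =
      ¬≁⇒~ (separated ua xa ∘ sym) λ xu → P₃∪P₂-free bc (≁-sym xu) xt ut
        (~-sym ub , ~-sym xb , ~-sym tb) (~-sym uc , ~-sym xc , ~-sym tc)

    D∪~T : ∀ {x u} → D∪ x → T a b c u → u ~ t → x ~ u
    D∪~T x∈ Tu ut with D∪-misses x∈
    D∪~T (inj₁ x∈)        Tu ut | xt , _ = D~T tri Tt Tu ut x∈ xt
    D∪~T (inj₂ (inj₁ x∈)) Tu ut | xt , _ = D~T (rotate tri) (T-rotate Tt) (T-rotate Tu) ut x∈ xt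
    D∪~T (inj₂ (inj₂ x∈)) Tu ut | xt , _ =
      D~T (rotate (rotate tri)) (T-rotate (T-rotate Tt)) (T-rotate (T-rotate Tu)) ut x∈ xt

    class : V → List V
    class r = r ∷ filter (r ≁?_) (Ts a b c)

    ∈-class⁻ : ∀ {r v} → v ∈ filter (r ≁?_) (Ts a b c) → T a b c v × r ≁ v
    ∈-class⁻ {r} v∈ with ∈-filter⁻ (r ≁?_) {xs = Ts a b c} v∈
    ... | v∈T , rv = ∈-listOf⁻ (T? a b c) v∈T , rv

    class-stable : ∀ {r} → T a b c r → Stable (class r)
    class-stable {r} Tr (here refl) (here refl) = irrefl G r
    class-stable Tr (here refl) (there v∈) = ≁⇒¬~ (proj₂ (∈-class⁻ v∈))
    class-stable Tr (there u∈) (here refl) = ≁⇒¬~ (proj₂ (∈-class⁻ u∈)) ∘ ~-sym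
    class-stable Tr (there u∈) (there v∈) uv with ∈-class⁻ u∈ | ∈-class⁻ v∈
    ... | Tu , ru | Tv , rv = ≁⇒¬~ (T-transitive Tu Tr Tv (≁-sym ru) rv (~⇒≢ uv)) uv

    Sorted : V → Set
    Sorted v = v ∈ a ∷ b ∷ c ∷ [] ⊎ v ∈ Ns a b c ⊎ v ∈ Ns b c a ⊎ v ∈ Ns c a b ⊎ v ∈ listOf D∪? ⊎ T a b c v

    sort : ∀ v → Sorted v
    sort v with position tri v
    ... | corner v∈ = inj₁ v∈
    ... | inNa v∈ = inj₂ (inj₁ (∈-listOf⁺ (N? a b c) v∈))
    ... | inNb v∈ = inj₂ (inj₂ (inj₁ (∈-listOf⁺ (N? b c a) v∈)))
    ... | inNc v∈ = inj₂ (inj₂ (inj₂ (inj₁ (∈-listOf⁺ (N? c a b) v∈))))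
    ... | inDa v∈ = inj₂ (inj₂ (inj₂ (inj₂ (inj₁ (∈-listOf⁺ D∪? (inj₁ v∈))))))
    ... | inDb v∈ = inj₂ (inj₂ (inj₂ (inj₂ (inj₁ (∈-listOf⁺ D∪? (inj₂ (inj₁ v∈)))))))
    ... | inDc v∈ = inj₂ (inj₂ (inj₂ (inj₂ (inj₁ (∈-listOf⁺ D∪? (inj₂ (inj₂ v∈)))))))
    ... | inT v∈ = inj₂ (inj₂ (inj₂ (inj₂ (inj₂ v∈))))

    -- `R` represents every component of `≁` on `T` other than that of `t`, and it extends the
    -- clique of the three D. The corners, the three N, the D and the components thus take at most 1
    -- + 3(w - 1) + w + 1 = 4w - 1 colours.
    χ-bound : χ G ≤ 4 * w
    χ-bound with maximal-clique (listOf Tᵗ?)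
    ... | R , R-clique , R⊆ , R-max = Cover⇒χ≤ (Cover-map (λ {v} _ → sort v) size≤
          (one-class _ (corners-stable tri)
           ⊕ singletons (Ns a b c) ⊕ singletons (Ns b c a) ⊕ singletons (Ns c a b)
           ⊕ singletons (listOf D∪?)
           ⊕ Cover-map sort-T ≤-refl (one-class (class t) (class-stable Tt) ⊕ R-classes)))
      where
      R-T : ∀ {r} → r ∈ R → T a b c r × r ~ t
      R-T r∈ = ∈-listOf⁻ Tᵗ? (R⊆ r∈)
      DR-clique : Clique (listOf D∪? ++ R)
      DR-clique = AllPairs.++⁺ D∪-clique R-clique
        (All.tabulate λ x∈ → All.tabulate λ r∈ → let (Tr , rt) = R-T r∈ in D∪~T (∈-listOf⁻ D∪? x∈) Tr rt)
      R-classes : Cover (λ v → Any (λ r → v ∈ class r) R) (length R)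
      R-classes = map-cover class R (All.tabulate (λ r∈ → class-stable (proj₁ (R-T r∈)))) id
      in-class : ∀ {r v} → T a b c v → v ≁ r → v ∈ class r
      in-class {r} Tv vr = there (∈-filter⁺ (r ≁?_) (∈-listOf⁺ (T? a b c) Tv) (≁-sym vr))
      sort-T : ∀ {v} → T a b c v → v ∈ class t ⊎ Any (λ r → v ∈ class r) R
      sort-T {v} Tv with v ≟ t
      ... | yes refl = inj₁ (here refl)
      ... | no v≢t with ≢⇒~⊎≁ v≢t
      ...   | inj₂ vt = inj₁ (in-class Tv vt)
      ...   | inj₁ vt = inj₂ ([ Any.map here , Any.map (in-class Tv) ]′ (R-max (∈-listOf⁺ Tᵗ? (Tv , vt))))
      size≤ : 1 + (length (Ns a b c) + (length (Ns b c a) + (length (Ns c a b) + (length (listOf D∪?) + (1 + length R))))) ≤ 4 * w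
      size≤ = ≤-trans (n≤1+n _) (subst₂ _≤_
        (lhs (length (Ns a b c)) (length (Ns b c a)) (length (Ns c a b)) (length (listOf D∪?)) (length R)) (rhs w)
        (+-mono-≤ (N-bound tri) (+-mono-≤ (N-bound (rotate tri)) (+-mono-≤ (N-bound (rotate (rotate tri)))
          (subst (_≤ w) (length-++ (listOf D∪?)) (clique≤ω DR-clique))))))
        where
        lhs : ∀ x y z d r → suc x + (suc y + (suc z + (d + r))) ≡ suc (1 + (x + (y + (z + (d + (1 + r))))))
        lhs = solve-∀
        rhs : ∀ w → w + (w + (w + w)) ≡ 4 * w
        rhs = solve-∀

    outside? : ∀ (R : List V) → Decidable (_∉ R)
    outside? R v = ¬? (Any.any? (v ≟_) R)

    -- A vertex outside three successive maximal cliques would lie at the end of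
    -- a non-adjacency chain through all of them, giving four independent vertices.
    T-listing : Listing (T a b c) (w + (w + w))
    T-listing with maximal-clique (Ts a b c)
    ... | R₁ , R₁-clique , R₁⊆ , R₁-max with maximal-clique (filter (outside? R₁) (Ts a b c))
    ... | R₂ , R₂-clique , R₂⊆ , R₂-max with maximal-clique (filter (outside? R₂) (filter (outside? R₁) (Ts a b c)))
    ... | R₃ , R₃-clique , R₃⊆ , R₃-max = Listing-map exhaust
          (+-mono-≤ (clique≤ω R₁-clique) (+-mono-≤ (clique≤ω R₂-clique) (clique≤ω R₃-clique)))
          (listing R₁ ⊞ listing R₂ ⊞ listing R₃)
      where
      T₁ T₂ : List V
      T₁ = filter (outside? R₁) (Ts a b c)
      T₂ = filter (outside? R₂) T₁

      T₁⁻ : ∀ {v} → v ∈ T₁ → T a b c v × v ∉ R₁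
      T₁⁻ v∈ with ∈-filter⁻ (outside? R₁) {xs = Ts a b c} v∈
      ... | v∈T , v∉ = ∈-listOf⁻ (T? a b c) v∈T , v∉

      T₂⁻ : ∀ {v} → v ∈ T₂ → v ∈ T₁ × v ∉ R₂
      T₂⁻ = ∈-filter⁻ (outside? R₂) {xs = T₁}

      chain : ∀ {v r₃ r₂ r₁} → T a b c v → v ∉ R₁ → v ∉ R₂ → r₃ ∈ R₃ → r₂ ∈ R₂ → r₁ ∈ R₁ →
              v ≁ r₃ → r₃ ≁ r₂ → r₂ ≁ r₁ → ⊥
      chain Tv v∉₁ v∉₂ r₃∈ r₂∈ r₁∈ vr₃ r₃r₂ r₂r₁ = K₄-free vr₃ vr₂ vr₁ r₃r₂ r₃r₁ r₂r₁
        where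
        r₃∈T₁ = proj₁ (T₂⁻ (R₃⊆ r₃∈))
        Tr₃ = proj₁ (T₁⁻ r₃∈T₁)
        Tr₂ = proj₁ (T₁⁻ (R₂⊆ r₂∈))
        Tr₁ = ∈-listOf⁻ (T? a b c) (R₁⊆ r₁∈)
        vr₂ = T-transitive Tv Tr₃ Tr₂ vr₃ r₃r₂ λ { refl → v∉₂ r₂∈ }
        r₃r₁ = T-transitive Tr₃ Tr₂ Tr₁ r₃r₂ r₂r₁ λ { refl → proj₂ (T₁⁻ r₃∈T₁) r₁∈ }
        vr₁ = T-transitive Tv Tr₂ Tr₁ vr₂ r₂r₁ λ { refl → v∉₁ r₁∈ }

      exhaust : ∀ {v} → T a b c v → v ∈ R₁ ⊎ v ∈ R₂ ⊎ v ∈ R₃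
      exhaust {v} Tv with Any.any? (v ≟_) R₁ | Any.any? (v ≟_) R₂
      ... | yes v∈ | _ = inj₁ v∈
      ... | no _ | yes v∈ = inj₂ (inj₁ v∈)
      ... | no v∉₁ | no v∉₂
        with R₃-max (∈-filter⁺ (outside? R₂) (∈-filter⁺ (outside? R₁) (∈-listOf⁺ (T? a b c) Tv) v∉₁) v∉₂)
      ... | inj₁ v∈ = inj₂ (inj₂ v∈)
      ... | inj₂ v≁R₃ with find v≁R₃
      ...   | r₃ , r₃∈ , vr₃ with R₂-max (proj₁ (T₂⁻ (R₃⊆ r₃∈)))
      ...     | inj₁ r₃∈₂ = ⊥-elim (proj₂ (T₂⁻ (R₃⊆ r₃∈)) r₃∈₂)
      ...     | inj₂ r₃≁R₂ with find r₃≁R₂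
      ...       | r₂ , r₂∈ , r₃r₂ with R₁-max (∈-listOf⁺ (T? a b c) (proj₁ (T₁⁻ (R₂⊆ r₂∈))))
      ...         | inj₁ r₂∈₁ = ⊥-elim (proj₂ (T₁⁻ (R₂⊆ r₂∈)) r₂∈₁)
      ...         | inj₂ r₂≁R₁ with find r₂≁R₁
      ...           | r₁ , r₁∈ , r₂r₁ = ⊥-elim (chain Tv v∉₁ v∉₂ r₃∈ r₂∈ r₁∈ vr₃ r₃r₂ r₂r₁)

    -- The corners and the three N account for at most 3w vertices, the D for w and `T` for 3w.
    n-bound : n ≤ 7 * w
    n-bound = Listing⇒n≤ (Listing-map (λ {v} _ → sort v) size≤
      (listing (a ∷ b ∷ c ∷ []) ⊞ listing (Ns a b c) ⊞ listing (Ns b c a) ⊞ listing (Ns c a b)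
       ⊞ listing (listOf D∪?) ⊞ T-listing))
      where
      size≤ : 3 + (length (Ns a b c) + (length (Ns b c a) + (length (Ns c a b) + (length (listOf D∪?) + (w + (w + w)))))) ≤ 7 * w
      size≤ = subst₂ _≤_
        (lhs (length (Ns a b c)) (length (Ns b c a)) (length (Ns c a b)) (length (listOf D∪?) + (w + (w + w)))) (rhs w)
        (+-mono-≤ (N-bound tri) (+-mono-≤ (N-bound (rotate tri)) (+-mono-≤ (N-bound (rotate (rotate tri)))
          (+-monoˡ-≤ (w + (w + w)) (clique≤ω D∪-clique)))))
        where
        lhs : ∀ x y z r → suc x + (suc y + (suc z + r)) ≡ 3 + (x + (y + (z + r)))
        lhs = solve-∀
        rhs : ∀ w → w + (w + (w + (w + (w + (w + w))))) ≡ 7 * w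
        rhs = solve-∀

  -- Sets on which non-adjacency is a matching.

  infix 4 _∈ᵖ_

  _∈ᵖ_ : V → V × V → Set
  v ∈ᵖ p = v ≡ proj₁ p ⊎ v ≡ proj₂ p

  Joined : V × V → V × V → Set
  Joined p q = ∀ {u v} → u ∈ᵖ p → v ∈ᵖ q → u ~ v

  Mates : (V → Set) → V × V → Set
  Mates X p = X (proj₁ p) × X (proj₂ p) × proj₁ p ≁ proj₂ p

  Matching : (V → Set) → Set
  Matching X = ∀ {x y z} → X x → X y → X z → y ≁ x → y ≁ z → x ≡ z

  -- The matched pairs and the unmatched vertices of `≁` on `X`. One end of each pair together with
  -- the `singles` is a clique of `parts` vertices, while `parts` colours also suffice for `X`; the
  -- vertex count `total` exceeds `parts` by `excess`.
  record Split (X : V → Set) : Set where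
    field
      pairs          : List (V × V)
      singles        : List V
      mates          : All (Mates X) pairs
      alone          : All X singles
      exhausts       : ∀ {v} → X v → v ∈ singles ⊎ Any (v ∈ᵖ_) pairs
      pairs-joined   : AllPairs Joined pairs
      singles-clique : Clique singles
      singles-joined : ∀ {u v p} → u ∈ singles → p ∈ pairs → v ∈ᵖ p → u ~ v

    excess : ℕ
    excess = length pairs

    parts : ℕ
    parts = length singles + length pairs

    total : ℕ
    total = parts + length pairs

  open Split

  Split-map : ∀ {X Y} → (∀ {v} → X v → Y v) → (∀ {v} → Y v → X v) → Split X → Split Y
  Split-map X⊆Y Y⊆X S = record
    { pairs = S .pairs ; singles = S .singles
    ; mates = All.map (λ (x , y , xy) → X⊆Y x , X⊆Y y , xy) (S .mates)
    ; alone = All.map X⊆Y (S .alone) ; exhausts = S .exhausts ∘ Y⊆X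
    ; pairs-joined = S .pairs-joined ; singles-clique = S .singles-clique
    ; singles-joined = S .singles-joined }

  split : ∀ {X} → Decidable X → Matching X → Split X
  split {X} X? matching = record
    { pairs = filter Q? all-pairs
    ; singles = listOf alone?
    ; mates = All.tabulate λ p∈ → proj₁ (Q⁻ p∈)
    ; alone = All.tabulate λ v∈ → proj₁ (∈-listOf⁻ alone? v∈)
    ; exhausts = exhausts′
    ; pairs-joined = allPairs-from-unique
        (Unique.filter⁺ Q? (Unique.cartesianProduct⁺ (Unique.allFin⁺ n) (Unique.allFin⁺ n)))
        λ p∈ q∈ p≢q → joined (Q⁻ p∈) (Q⁻ q∈) p≢q
    ; singles-clique = listOf-clique alone? λ (Xu , u-alone) (Xv , _) u≢v →
        ¬≁⇒~ u≢v λ uv → u-alone (_ , Xv , ≁-sym uv)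
    ; singles-joined = λ u∈ p∈ v∈p → single-joined (∈-listOf⁻ alone? u∈) (proj₁ (Q⁻ p∈)) v∈p }
    where
    all-pairs : List (V × V)
    all-pairs = cartesianProduct (allFin n) (allFin n)

    -- Of the two orders of each pair only the increasing one is kept, so that no pair is listed
    -- twice.
    Q : V × V → Set
    Q p = Mates X p × proj₁ p <ᶠ proj₂ p

    Q? : Decidable Q
    Q? (u , v) = (X? u ×-dec X? v ×-dec (u ≁? v)) ×-dec (u <ᶠ? v)

    Q⁻ : ∀ {p} → p ∈ filter Q? all-pairs → Q p
    Q⁻ p∈ = proj₂ (∈-filter⁻ Q? {xs = all-pairs} p∈)

    Q⁺ : ∀ {p} → Q p → p ∈ filter Q? all-pairs
    Q⁺ {u , v} = ∈-filter⁺ Q? (∈-cartesianProduct⁺ (∈-allFin u) (∈-allFin v))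

    alone? : Decidable (λ v → X v × ¬ ∃ λ u → X u × u ≁ v)
    alone? v = X? v ×-dec ¬? (any? λ u → X? u ×-dec (u ≁? v))

    exhausts′ : ∀ {v} → X v → v ∈ listOf alone? ⊎ Any (v ∈ᵖ_) (filter Q? all-pairs)
    exhausts′ {v} Xv with any? (λ u → X? u ×-dec (u ≁? v))
    ... | no alone = inj₁ (∈-listOf⁺ alone? (Xv , alone))
    ... | yes (u , Xu , uv) with <ᶠ-cmp u v
    ...   | tri< u<v _ _ = inj₂ (lose (Q⁺ ((Xu , Xv , uv) , u<v)) (inj₂ refl))
    ...   | tri≈ _ u≡v _ = ⊥-elim (proj₁ uv u≡v)
    ...   | tri> _ _ v<u = inj₂ (lose (Q⁺ ((Xv , Xu , ≁-sym uv) , v<u)) (inj₁ refl))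

    member : ∀ {p v} → Mates X p → v ∈ᵖ p → X v
    member (Xa , _ , _) (inj₁ refl) = Xa
    member (_ , Xb , _) (inj₂ refl) = Xb

    mate-member : ∀ {p u v} → Mates X p → u ∈ᵖ p → X v → u ≁ v → v ∈ᵖ p
    mate-member (Xa , Xb , ab) (inj₁ refl) Xv uv = inj₂ (matching Xv Xa Xb uv ab)
    mate-member (Xa , Xb , ab) (inj₂ refl) Xv uv = inj₁ (matching Xv Xb Xa uv (≁-sym ab))

    same-pair : ∀ {p q v} → Q p → Q q → v ∈ᵖ p → v ∈ᵖ q → p ≡ q
    same-pair ((Xa , Xb , ab) , _) ((_ , Xd , cd) , _) (inj₁ refl) (inj₁ refl) =
      cong (_ ,_) (matching Xb Xa Xd ab cd)
    same-pair ((Xa , Xb , ab) , _) ((Xc , Xd , cd) , _) (inj₂ refl) (inj₂ refl) =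
      cong (_, _) (matching Xa Xb Xc (≁-sym ab) (≁-sym cd))
    same-pair ((Xa , Xb , ab) , a<b) ((Xc , Xd , cd) , c<d) (inj₁ refl) (inj₂ refl)
      with refl ← matching Xb Xa Xc ab (≁-sym cd) = ⊥-elim (<ᶠ-asym a<b c<d)
    same-pair ((Xa , Xb , ab) , a<b) ((Xc , Xd , cd) , c<d) (inj₂ refl) (inj₁ refl)
      with refl ← matching Xa Xb Xd (≁-sym ab) cd = ⊥-elim (<ᶠ-asym a<b c<d)

    joined : ∀ {p q} → Q p → Q q → p ≢ q → Joined p q
    joined Qp Qq p≢q u∈ v∈ = ¬≁⇒~ (λ { refl → p≢q (same-pair Qp Qq u∈ v∈) })
      λ uv → p≢q (same-pair Qp Qq (mate-member (proj₁ Qp) u∈ (member (proj₁ Qq) v∈) uv) v∈)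

    single-joined : ∀ {u v p} → X u × ¬ (∃ λ v → X v × v ≁ u) → Mates X p → v ∈ᵖ p → u ~ v
    single-joined (Xu , alone) Mp@(Xa , Xb , ab) v∈ = ¬≁⇒~
      (λ { refl → alone (has-mate Mp v∈) }) λ uv → alone (_ , member Mp v∈ , ≁-sym uv)
      where
      has-mate : ∀ {p v} → Mates X p → v ∈ᵖ p → ∃ λ u → X u × u ≁ v
      has-mate (_ , Xb , ab) (inj₁ refl) = _ , Xb , ≁-sym ab
      has-mate (Xa , _ , ab) (inj₂ refl) = _ , Xa , ab

  Transversal : List (V × V) → List V → Set
  Transversal = Pointwise (λ p v → v ∈ᵖ p)

  transversal-source : ∀ {ps vs v} → Transversal ps vs → v ∈ vs → Any (v ∈ᵖ_) ps
  transversal-source (v∈p ∷ _)  (here refl) = here v∈p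
  transversal-source (_ ∷ rest) (there v∈)  = there (transversal-source rest v∈)

  transversal-clique : ∀ {ps vs} → AllPairs Joined ps → Transversal ps vs → Clique vs
  transversal-clique [] [] = []
  transversal-clique (p-joined ∷ joined) (v∈p ∷ rest) =
    All.tabulate (λ u∈ → let (q , q∈ , u∈q) = find (transversal-source rest u∈) in All.lookup p-joined q∈ v∈p u∈q)
    ∷ transversal-clique joined rest

  choose : ∀ {R : V → Set} ps → (∀ {p} → p ∈ ps → ∃ λ v → v ∈ᵖ p × R v) →
           ∃ λ vs → Transversal ps vs × All R vs
  choose [] f = [] , [] , []
  choose (p ∷ ps) f with f (here refl) | choose ps (f ∘ there)
  ... | v , v∈p , Rv | vs , tr , Rvs = v ∷ vs , v∈p ∷ tr , Rv ∷ Rvs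

  seconds : ∀ ps → Transversal ps (map proj₂ ps)
  seconds []       = []
  seconds (p ∷ ps) = inj₂ refl ∷ seconds ps

  module _ {X} (S : Split X) where

    split-member : ∀ {v} → v ∈ S .singles ⊎ Any (v ∈ᵖ_) (S .pairs) → X v
    split-member (inj₁ v∈) = All.lookup (S .alone) v∈
    split-member (inj₂ v∈) with find v∈
    ... | p , p∈ , inj₁ refl = proj₁ (All.lookup (S .mates) p∈)
    ... | p , p∈ , inj₂ refl = proj₁ (proj₂ (All.lookup (S .mates) p∈))

    split-clique : ∀ {vs} → Transversal (S .pairs) vs → Clique (S .singles ++ vs)
    split-clique tr = AllPairs.++⁺ (S .singles-clique) (transversal-clique (S .pairs-joined) tr)
      (All.tabulate λ u∈ → All.tabulate λ v∈ →
        let (p , p∈ , v∈p) = find (transversal-source tr v∈) in S .singles-joined u∈ p∈ v∈p)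

    split-clique⊆ : ∀ {vs} → Transversal (S .pairs) vs → All X (S .singles ++ vs)
    split-clique⊆ tr = All.++⁺ (S .alone) (All.tabulate λ v∈ → split-member (inj₂ (transversal-source tr v∈)))

    -- The clique consists of `a`, the `singles` and the second end of each pair.
    parts-bound : ∀ {a} → (∀ {v} → X v → v ~ a) → suc (parts S) ≤ w
    parts-bound X~a = subst (λ k → suc k ≤ w)
      (trans (length-++ (S .singles)) (cong (length (S .singles) +_) (length-map proj₂ (S .pairs))))
      (clique≤ω (All.map (~-sym ∘ X~a) (split-clique⊆ (seconds _)) ∷ split-clique (seconds _)))

    split-cover : Cover X (parts S)
    split-cover = Cover-map (S .exhausts) ≤-refl
      (singletons (S .singles) ⊕ map-cover (λ p → proj₁ p ∷ proj₂ p ∷ []) (S .pairs)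
        (All.map (λ (_ , _ , uv) {u} {v} → stable-[x,y] uv {u} {v}) (S .mates))
        (Any.map [ here , there ∘ here ]′))

    split-listing : Listing X (total S)
    split-listing = Listing-map sort
      (≤-reflexive (trans (sym (+-assoc (length (S .singles)) _ _))
        (cong₂ (λ k l → length (S .singles) + k + l) (length-map proj₁ (S .pairs)) (length-map proj₂ (S .pairs)))))
      (listing (S .singles) ⊞ listing (map proj₁ (S .pairs)) ⊞ listing (map proj₂ (S .pairs)))
      where
      sort : ∀ {v} → X v → v ∈ S .singles ⊎ v ∈ map proj₁ (S .pairs) ⊎ v ∈ map proj₂ (S .pairs)
      sort Xv with S .exhausts Xv
      ... | inj₁ v∈ = inj₁ v∈
      ... | inj₂ v∈ with find v∈
      ...   | p , p∈ , inj₁ refl = inj₂ (inj₁ (∈-map⁺ proj₁ p∈))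
      ...   | p , p∈ , inj₂ refl = inj₂ (inj₂ (∈-map⁺ proj₂ p∈))

  -- One vertex is removed from each pair; removed vertices of the two
  -- families share colour classes.
  share : ∀ k (xs ys : List (V × V)) → length xs ≤ k → length ys ≤ k →
    (∀ {p q} → p ∈ xs → q ∈ ys → proj₁ p ≁ proj₁ q ⊎ proj₁ p ≁ proj₂ q) →
    ∃ λ vs → ∃ λ rs → Transversal ys vs × (∀ {v} → Any (v ∈ᵖ_) ys → v ∈ vs ⊎ v ∈ rs) ×
    Cover (λ v → v ∈ map proj₁ xs ⊎ v ∈ rs) k
  share k [] [] _ _ _ = [] , [] , [] , (λ ()) , record
    { classes = [] ; stable = [] ; covers = λ { (inj₁ ()) ; (inj₂ ()) } ; size = z≤n }
  share (suc k) (p ∷ xs) [] (s≤s xs≤k) _ _ with share k xs [] xs≤k z≤n (λ _ ())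
  ... | vs , rs , tr , leftover , C = vs , rs , tr , leftover ,
    Cover-map (λ { (inj₁ (here v≡)) → inj₁ (here v≡) ; (inj₁ (there v∈)) → inj₂ (inj₁ v∈) ; (inj₂ v∈) → inj₂ (inj₂ v∈) })
      ≤-refl (singletons (proj₁ p ∷ []) ⊕ C)
  share (suc k) [] (q ∷ ys) _ (s≤s ys≤k) _ with share k [] ys z≤n ys≤k (λ ())
  ... | vs , rs , tr , leftover , C = proj₁ q ∷ vs , proj₂ q ∷ rs , inj₁ refl ∷ tr ,
    (λ { (here (inj₁ v≡)) → inj₁ (here v≡) ; (here (inj₂ v≡)) → inj₂ (here v≡)
       ; (there v∈) → [ inj₁ ∘ there , inj₂ ∘ there ]′ (leftover v∈) }) ,
    Cover-map (λ { (inj₁ ()) ; (inj₂ (here v≡)) → inj₁ (here v≡) ; (inj₂ (there v∈)) → inj₂ (inj₂ v∈) })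
      ≤-refl (singletons (proj₂ q ∷ []) ⊕ C)
  share (suc k) (p ∷ xs) (q ∷ ys) (s≤s xs≤k) (s≤s ys≤k) misses
    with share k xs ys xs≤k ys≤k (λ p∈ q∈ → misses (there p∈) (there q∈)) | misses (here refl) (here refl)
  ... | vs , rs , tr , leftover , C | inj₁ pq = proj₂ q ∷ vs , proj₁ q ∷ rs , inj₂ refl ∷ tr ,
    (λ { (here (inj₁ v≡)) → inj₂ (here v≡) ; (here (inj₂ v≡)) → inj₁ (here v≡)
       ; (there v∈) → [ inj₁ ∘ there , inj₂ ∘ there ]′ (leftover v∈) }) ,
    Cover-map (λ { (inj₁ (here v≡)) → inj₁ (here v≡) ; (inj₁ (there v∈)) → inj₂ (inj₁ v∈)
                 ; (inj₂ (here v≡)) → inj₁ (there (here v≡)) ; (inj₂ (there v∈)) → inj₂ (inj₂ v∈) })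
      ≤-refl (one-class (proj₁ p ∷ proj₁ q ∷ []) (stable-[x,y] pq) ⊕ C)
  ... | vs , rs , tr , leftover , C | inj₂ pq = proj₁ q ∷ vs , proj₂ q ∷ rs , inj₁ refl ∷ tr ,
    (λ { (here (inj₁ v≡)) → inj₁ (here v≡) ; (here (inj₂ v≡)) → inj₂ (here v≡)
       ; (there v∈) → [ inj₁ ∘ there , inj₂ ∘ there ]′ (leftover v∈) }) ,
    Cover-map (λ { (inj₁ (here v≡)) → inj₁ (here v≡) ; (inj₁ (there v∈)) → inj₂ (inj₁ v∈)
                 ; (inj₂ (here v≡)) → inj₁ (there (here v≡)) ; (inj₂ (there v∈)) → inj₂ (inj₂ v∈) })
      ≤-refl (one-class (proj₁ p ∷ proj₂ q ∷ []) (stable-[x,y] pq) ⊕ C)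

  -- The remaining case: no stable triple is joined to a non-adjacent pair.

  K₃∪K₂-Free : Set
  K₃∪K₂-Free = ∀ {x y z u v} → Triangle x y z → u ≁ v → T x y z u → T x y z v → ⊥

  module NoJoined (K₃∪K₂-free : K₃∪K₂-Free) where

    -- Distinct non-neighbours `x` and `z` of `y` would form with `y` a path or a triangle of `≁`
    -- joined to the pair `u`, `v`; the path is forbidden and the triangle is excluded in this case.
    -- `T x y z u` only abbreviates that `u` is adjacent to all three.
    common-matching : ∀ {u v x y z} → u ≁ v → T x y z u → T x y z v → y ≁ x → y ≁ z → x ≡ z
    common-matching {x = x} {z = z} uv Tu Tv yx yz with x ≟ z
    ... | yes x≡z = x≡z
    ... | no x≢z with ≢⇒~⊎≁ x≢z
    ...   | inj₁ xz = ⊥-elim (P₃∪P₂-free uv (≁-sym yx) yz xz Tu Tv)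
    ...   | inj₂ xz = ⊥-elim (K₃∪K₂-free (triangle (≁-sym yx) yz (≁-sym xz)) uv Tu Tv)

    -- For a stable triple `a`, `b`, `c` this is `D b c a` together with `T a b c`; taken at once,
    -- they have a single matching and a single colour bound.
    Between : V → V → V → Set
    Between a c v = v ~ a × v ~ c

    between-split : ∀ {a c} → a ≁ c → Split (Between a c)
    between-split {a} {c} ac = split (λ v → (v ~? a) ×-dec (v ~? c)) λ (xa , xc) (ya , yc) (za , zc) →
      common-matching ac (~-sym xa , ~-sym ya , ~-sym za) (~-sym xc , ~-sym yc , ~-sym zc)

    D-split : ∀ {a b c} → Triangle a b c → Split (D a b c)
    D-split {a} {b} {c} (triangle _ bc _) = split (D? a b c) λ (_ , xb , xc) (_ , yb , yc) (_ , zb , zc) →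
      common-matching bc (~-sym xb , ~-sym yb , ~-sym zb) (~-sym xc , ~-sym yc , ~-sym zc)

    -- Without stable triples the non-neighbours of any vertex form a clique. For non-adjacent `d`
    -- and `e`, their non-neighbours and the vertices adjacent to both exhaust `G`, which gives at
    -- most 3w colours and 4w vertices.
    triangle-free : (∀ {x y z} → ¬ Triangle x y z) → Goal
    triangle-free no-triangle with any? (λ d → any? (λ e → d ≁? e))
    ... | no complete = Listing⇒n≤ (Listing-map (λ {v} _ → ∈-allFin v) (≤-trans all≤w (m≤m+n w (6 * w))) (listing (allFin n)))
          , Cover⇒χ≤ (Cover-map (λ {v} _ → ∈-allFin v) (≤-trans all≤w (m≤m+n w (3 * w))) (singletons (allFin n)))
      where
      all≤w : length (allFin n) ≤ w
      all≤w = clique≤ω (allPairs-from-unique (Unique.allFin⁺ n)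
        λ {u} {v} _ _ u≢v → ¬≁⇒~ u≢v λ uv → complete (u , v , uv))
    ... | yes (d , e , de) =
      Listing⇒n≤ (Listing-map (λ {v} _ → sort v) n≤ (listing (listOf (d ≁?_)) ⊞ listing (listOf (e ≁?_)) ⊞ split-listing S))
      , Cover⇒χ≤ (Cover-map (λ {v} _ → sort v) χ≤ (singletons (listOf (d ≁?_)) ⊕ singletons (listOf (e ≁?_)) ⊕ split-cover S))
      where
      S = between-split de

      sort : ∀ v → v ∈ listOf (d ≁?_) ⊎ v ∈ listOf (e ≁?_) ⊎ Between d e v
      sort v with v ≟ d | v ≟ e
      ... | yes refl | _ = inj₂ (inj₁ (∈-listOf⁺ (e ≁?_) (≁-sym de)))
      ... | _ | yes refl = inj₁ (∈-listOf⁺ (d ≁?_) de)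
      ... | no v≢d | no v≢e with ≢⇒~⊎≁ v≢d | ≢⇒~⊎≁ v≢e
      ...   | inj₂ vd | _ = inj₁ (∈-listOf⁺ (d ≁?_) (≁-sym vd))
      ...   | _ | inj₂ ve = inj₂ (inj₁ (∈-listOf⁺ (e ≁?_) (≁-sym ve)))
      ...   | inj₁ vd | inj₁ ve = inj₂ (inj₂ (vd , ve))

      missing-clique : ∀ x → length (listOf (x ≁?_)) ≤ w
      missing-clique x = clique≤ω (listOf-clique (x ≁?_) λ xu xv u≢v →
        ¬≁⇒~ u≢v λ uv → no-triangle (triangle xu uv (≁-sym xv)))

      parts≤w : parts S ≤ w
      parts≤w = ≤-trans (n≤1+n _) (parts-bound S proj₁)

      χ≤ : length (listOf (d ≁?_)) + (length (listOf (e ≁?_)) + parts S) ≤ 4 * w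
      χ≤ = +-mono-≤ (missing-clique d) (+-mono-≤ (missing-clique e) (≤-trans parts≤w (m≤m+n w _)))

      n≤ : length (listOf (d ≁?_)) + (length (listOf (e ≁?_)) + total S) ≤ 7 * w
      n≤ = +-mono-≤ (missing-clique d) (+-mono-≤ (missing-clique e)
        (+-mono-≤ parts≤w (≤-trans (m≤n+m (excess S) (length (S .singles))) (≤-trans parts≤w (m≤m+n w _)))))

    -- A stable triple with a maximal set of common neighbours.

    module Extremal {Core : V → Set} (core? : Decidable Core)
      (maximal : ∀ {x y z} → Triangle x y z → (∀ {v} → Core v → T x y z v) → ∀ {v} → T x y z v → Core v) where

      Cores : List V
      Cores = listOf core?

      τ : ℕ
      τ = length Cores

      -- By `maximal`, `Core` is then all of `T a b c`. Since `Core` itself does not mention the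
      -- triple, it stays the same when `a`, `b`, `c` are reordered.
      record Base (a b c : V) : Set where
        constructor base
        field
          tri    : Triangle a b c
          Core⊆T : ∀ {v} → Core v → T a b c v

      open Base

      rotateᴮ : ∀ {a b c} → Base a b c → Base b c a
      rotateᴮ B = base (rotate (B .tri)) (T-rotate ∘ B .Core⊆T)

      -- The lemmas below compare `D a b c` with `D c a b`. Rotation and reversal bring every
      -- ordered pair of the three D into this position.
      reverseᴮ : ∀ {a b c} → Base a b c → Base c b a
      reverseᴮ B = base (rotate (reflect (B .tri))) λ Cv → let (va , vb , vc) = B .Core⊆T Cv in vc , vb , va

      D-swap : ∀ {a b c v} → D a b c v → D a c b v
      D-swap (va , vb , vc) = va , vc , vb

      split-swap : ∀ {a b c} → Split (D a b c) → Split (D a c b)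
      split-swap = Split-map D-swap D-swap

      HasCore : V → Set
      HasCore u = ∃ λ t → Core t × t ≁ u

      hasCore? : Decidable HasCore
      hasCore? u = any? λ t → core? t ×-dec (t ≁? u)

      core~core : ∀ {a b c t t′} → Base a b c → Core t → Core t′ → t ≢ t′ → t ~ t′
      core~core B Ct Ct′ t≢t′ = ¬≁⇒~ t≢t′ λ tt′ → K₃∪K₂-free (B .tri) tt′ (B .Core⊆T Ct) (B .Core⊆T Ct′)

      core-matching : ∀ {a b c t y z} → Base a b c → Core t → D a b c y → D a b c z → t ≁ y → t ≁ z → y ≡ z
      core-matching B Ct (_ , yb , yc) (_ , zb , zc) ty tz with B .Core⊆T Ct
      ... | _ , tb , tc = common-matching (Triangle.bc (B .tri))
            (~-sym yb , ~-sym tb , ~-sym zb) (~-sym yc , ~-sym tc , ~-sym zc) ty tz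

      -- Otherwise `t` and `z` would be two non-neighbours of `y` among the common neighbours of `b`
      -- and `c`, against `common-matching`; they differ because only `t` is adjacent to `a`.
      core~mate : ∀ {a b c t y z} → Base a b c → Core t → D a b c y → D a b c z → y ≁ z → t ~ y
      core~mate B Ct (ya , yb , yc) (za , zb , zc) yz with B .Core⊆T Ct
      ... | ta , tb , tc = ¬≁⇒~ (separated ta ya) λ ty → separated ta za
            (common-matching (Triangle.bc (B .tri))
              (~-sym tb , ~-sym yb , ~-sym zb) (~-sym tc , ~-sym yc , ~-sym zc) (≁-sym ty) yz)

      D-apart : ∀ {a b c x y} → D a b c y → D c a b x → y ≢ x
      D-apart (_ , _ , yc) (xc , _ , _) = separated yc xc

      -- Otherwise the pair `y`, `y′` would be joined to the path `x`, `c`, `b` of `≁`.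
      not-both-adjacent : ∀ {a b c x y y′} → Base a b c → D a b c y → D a b c y′ → y ≁ y′ → D c a b x →
                          y ~ x → y′ ~ x → ⊥
      not-both-adjacent B (_ , yb , yc) (_ , y′b , y′c) yy′ (xc , xa , xb) yx y′x =
        P₃∪P₂-free yy′ xc (≁-sym (Triangle.bc (B .tri))) xb (yx , yc , yb) (y′x , y′c , y′b)

      -- Otherwise y, x and x′ would form a triangle with a larger core, containing b.
      starred⇒HasCore : ∀ {a b c x x′ y} → Base a b c → D a b c y → D c a b x → D c a b x′ → x ≁ x′ →
                        y ≁ x → y ≁ x′ → HasCore y
      starred⇒HasCore {b = b} {x = x} {x′} {y} B (ya , yb , yc) Dx@(_ , _ , xb) Dx′@(_ , _ , x′b) xx′ yx yx′
        with hasCore? y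
      ... | yes has = has
      ... | no none = ⊥-elim (irrefl G b (proj₁ (proj₂ (B .Core⊆T
            (maximal (triangle yx xx′ (≁-sym yx′)) Core⊆ (~-sym yb , ~-sym xb , ~-sym x′b))))))
        where
        Core⊆ : ∀ {t} → Core t → T y x x′ t
        Core⊆ Ct = ¬≁⇒~ (separated (proj₁ (B .Core⊆T Ct)) ya) (λ ty → none (_ , Ct , ty))
                 , core~mate (rotateᴮ (rotateᴮ B)) Ct Dx Dx′ xx′
                 , core~mate (rotateᴮ (rotateᴮ B)) Ct Dx′ Dx (≁-sym xx′)

      -- Non-adjacency to both `x` and `x′` would give `y` a non-neighbour in `Core`, whereas
      -- `core~mate` makes the ends of a pair adjacent to all of `Core`.
      not-starred : ∀ {a b c x x′ y y′} → Base a b c → D a b c y → D a b c y′ → y ≁ y′ →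
                    D c a b x → D c a b x′ → x ≁ x′ → y ≁ x → y ≁ x′ → ⊥
      not-starred B Dy Dy′ yy′ Dx Dx′ xx′ yx yx′ with starred⇒HasCore B Dy Dx Dx′ xx′ yx yx′
      ... | t , Ct , ty = ≁⇒¬~ ty (core~mate B Ct Dy Dy′ yy′)

      -- This is `not-starred` with the two D exchanged. Together with `not-both-adjacent` it shows
      -- that an end of a pair in `D c a b` is non-adjacent to exactly one end of each pair in
      -- `D a b c`.
      adjacent-mate : ∀ {a b c x x′ y y′} → Base a b c → D a b c y → D a b c y′ → y ≁ y′ →
                      D c a b x → D c a b x′ → x ≁ x′ → y ≁ x → y′ ~ x
      adjacent-mate B Dy Dy′ yy′ Dx Dx′ xx′ yx = ¬≁⇒~ (D-apart Dy′ Dx) λ y′x →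
        not-starred (reverseᴮ B) (D-swap Dx) (D-swap Dx′) xx′ (D-swap Dy) (D-swap Dy′) yy′ (≁-sym yx) (≁-sym y′x)

      -- The clique consists of `b`, `x`, `Z`, `U` and, from each pair of `A`, an end adjacent to
      -- `x`, supplied by `adjacent-mate`. Both `x` and these ends are adjacent to `Z` by
      -- `core~mate`.
      big-clique : ∀ {a b c x x′ Z U} → Base a b c → (A : Split (D a b c)) →
        D c a b x → D c a b x′ → x ≁ x′ → Clique Z → All Core Z →
        Clique U → All (_∈ A .singles) U → All (_~ x) U → (∀ {z u} → z ∈ Z → u ∈ U → z ~ u) →
        2 + (length Z + (length U + excess A)) ≤ w
      big-clique {a} {b} {c} {x} {x′} {Z} {U} B A Dx Dx′ xx′ Z-clique Z-core U-clique U⊆ U~x Z~U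
        with choose (A .pairs) pick
        where
        pick : ∀ {p} → p ∈ A .pairs → ∃ λ v → v ∈ᵖ p × v ~ x
        pick {y , y′} p∈ with All.lookup (A .mates) p∈ | y ~? x
        ... | _ | yes yx = y , inj₁ refl , yx
        ... | Dy , Dy′ , yy′ | no ¬yx =
              y′ , inj₂ refl , adjacent-mate B Dy Dy′ yy′ Dx Dx′ xx′ (D-apart Dy Dx , ¬yx)
      ... | vs , tr , vs~x = subst (λ k → 2 + k ≤ w) lengths (clique≤ω
            ((~-sym (proj₂ (proj₂ Dx)) ∷ All.++⁺ (All.map b~core Z-core) (All.++⁺ (All.map b~D U-D) (All.map b~D vs-D)))
            ∷ All.++⁺ (All.map (λ Ct → ~-sym (core~mate (rotateᴮ (rotateᴮ B)) Ct Dx Dx′ xx′)) Z-core)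
                (All.++⁺ (All.map ~-sym U~x) (All.map ~-sym vs~x))
            ∷ AllPairs.++⁺ Z-clique
                (AllPairs.++⁺ U-clique (transversal-clique (A .pairs-joined) tr)
                  (All.tabulate λ u∈ → All.tabulate λ v∈ → let (p , p∈ , v∈p) = find (transversal-source tr v∈) in
                    A .singles-joined (All.lookup U⊆ u∈) p∈ v∈p))
                (All.tabulate λ z∈ → All.++⁺ (All.tabulate (Z~U z∈))
                  (All.tabulate λ v∈ → core~pair (All.lookup Z-core z∈) (find (transversal-source tr v∈))))))
        where
        U-D : All (D a b c) U
        U-D = All.map (All.lookup (A .alone)) U⊆
        vs-D : All (D a b c) vs
        vs-D = All.tabulate λ v∈ → split-member A (inj₂ (transversal-source tr v∈))
        b~core : ∀ {t} → Core t → b ~ t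
        b~core Ct = ~-sym (proj₁ (proj₂ (B .Core⊆T Ct)))
        b~D : ∀ {v} → D a b c v → b ~ v
        b~D (_ , vb , _) = ~-sym vb
        core~pair : ∀ {t v} → Core t → (∃ λ p → p ∈ A .pairs × v ∈ᵖ p) → t ~ v
        core~pair Ct (p , p∈ , v∈) with All.lookup (A .mates) p∈ | v∈
        ... | Dy , Dy′ , yy′ | inj₁ refl = core~mate B Ct Dy Dy′ yy′
        ... | Dy , Dy′ , yy′ | inj₂ refl = core~mate B Ct Dy′ Dy (≁-sym yy′)
        lengths : length (Z ++ U ++ vs) ≡ length Z + (length U + excess A)
        lengths = trans (length-++ Z) (cong (length Z +_) (trans (length-++ U)
          (cong (length U +_) (sym (Pointwise.Pointwise-length tr)))))

      cores-clique : ∀ {a b c} → Base a b c → Clique Cores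
      cores-clique B = listOf-clique core? λ Ct Ct′ → core~core B Ct Ct′

      all-Core : All Core Cores
      all-Core = All.tabulate (∈-listOf⁻ core?)

      core-bound : ∀ {a b c x x′} → Base a b c → (A : Split (D a b c)) →
        D c a b x → D c a b x′ → x ≁ x′ → 2 + (τ + excess A) ≤ w
      core-bound B A Dx Dx′ xx′ = big-clique B A Dx Dx′ xx′ (cores-clique B) all-Core [] [] [] λ _ ()

      -- A vertex of `Core` has at most one non-neighbour in `D a b c`, so distinct vertices of `us`
      -- have distinct partners, and `Z` is a clique of the same length.
      core-partners : ∀ {a b c} → Base a b c → ∀ {us} → All HasCore us → All (D a b c) us → Clique us →
        ∃ λ Z → Pointwise (λ u t → t ≁ u) us Z × All Core Z × Clique Z
      core-partners B [] [] [] = [] , [] , [] , []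
      core-partners {a} {b} {c} B {u ∷ us} ((t , Ct , tu) ∷ hs) (Du ∷ Ds) (u~us ∷ us-clique)
        with core-partners B hs Ds us-clique
      ... | Z , partners , Z-core , Z-clique = t ∷ Z , tu ∷ partners , Ct ∷ Z-core , apart Ds u~us partners Z-core ∷ Z-clique
        where
        apart : ∀ {us Z} → All (D a b c) us → All (u ~_) us → Pointwise (λ u t → t ≁ u) us Z → All Core Z → All (t ~_) Z
        apart [] [] [] [] = []
        apart (Dv ∷ Ds) (uv ∷ u~) (sv ∷ ps) (Cs ∷ Z-core) =
          core~core B Ct Cs (λ { refl → ~⇒≢ uv (core-matching B Ct Du Dv tu sv) }) ∷ apart Ds u~ ps Z-core

      -- Unmatched vertices of a D and the patterns on its pairs.

      module _ {a b c} (B : Base a b c) (A : Split (D a b c)) where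

        lone attached : List V
        lone = filter (λ u → ¬? (hasCore? u)) (A .singles)
        attached = filter hasCore? (A .singles)

        lone⁻ : ∀ {u} → u ∈ lone → u ∈ A .singles × ¬ HasCore u
        lone⁻ = ∈-filter⁻ (λ u → ¬? (hasCore? u)) {xs = A .singles}

        singles≤ : length (A .singles) ≤ length attached + length lone
        singles≤ = length-filter-⊎ hasCore? (λ u → ¬? (hasCore? u)) (A .singles) λ {u} _ → decide (hasCore? u)
          where
          decide : ∀ {P : Set} → Dec P → P ⊎ ¬ P
          decide (yes p) = inj₁ p
          decide (no ¬p) = inj₂ ¬p

        attached-partners : ∃ λ Z → length Z ≡ length attached × All Core Z × Clique Z
        attached-partners with core-partners B
          (All.tabulate (λ u∈ → proj₂ (∈-filter⁻ hasCore? {xs = A .singles} u∈)))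
          (All.tabulate (λ u∈ → All.lookup (A .alone) (proj₁ (∈-filter⁻ hasCore? {xs = A .singles} u∈))))
          (AllPairs.filter⁺ hasCore? (A .singles-clique))
        ... | Z , partners , Z-core , Z-clique = Z , sym (Pointwise.Pointwise-length partners) , Z-core , Z-clique

        -- Two pairs {x₁, x₁′}, {x₂, x₂′} of D c a b, each vertex of which is
        -- non-adjacent to exactly one end of every pair of D a b c.
        module TwoPairs {x₁ x₁′ x₂ x₂′}
          (D₁ : D c a b x₁) (D₁′ : D c a b x₁′) (x₁x₁′ : x₁ ≁ x₁′)
          (D₂ : D c a b x₂) (D₂′ : D c a b x₂′) (x₂x₂′ : x₂ ≁ x₂′)
          (x₁~x₂ : x₁ ~ x₂) (x₁~x₂′ : x₁ ~ x₂′) where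

          -- Putting the end non-adjacent to `x₁` first makes the pattern of `x₁` constant; other
          -- patterns are read off as differences from it.
          record Oriented (q : V × V) : Set where
            field
              mated : Mates (D a b c) q
              ≁x₁   : proj₁ q ≁ x₁
              ~x₁   : proj₂ q ~ x₁
          open Oriented

          orient : V × V → V × V
          orient (y , y′) with y ≁? x₁
          ... | yes _ = y , y′
          ... | no _  = y′ , y

          ∈-orient⁻ : ∀ p {v} → v ∈ᵖ orient p → v ∈ᵖ p
          ∈-orient⁻ (y , y′) v∈ with y ≁? x₁
          ... | yes _ = v∈
          ∈-orient⁻ (y , y′) (inj₁ v≡) | no _ = inj₂ v≡
          ∈-orient⁻ (y , y′) (inj₂ v≡) | no _ = inj₁ v≡

          orient-oriented : ∀ {p} → Mates (D a b c) p → Oriented (orient p)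
          orient-oriented {y , y′} M@(Dy , Dy′ , yy′) with y ≁? x₁
          ... | yes yx₁ = record { mated = M ; ≁x₁ = yx₁ ; ~x₁ = adjacent-mate B Dy Dy′ yy′ D₁ D₁′ x₁x₁′ yx₁ }
          ... | no ¬yx₁ with ¬≁⇒~ (D-apart Dy D₁) ¬yx₁
          ...   | yx₁ = record { mated = Dy′ , Dy , ≁-sym yy′ ; ~x₁ = yx₁
                  ; ≁x₁ = D-apart Dy′ D₁ , λ y′x₁ → not-both-adjacent B Dy Dy′ yy′ D₁ yx₁ y′x₁ }

          qs : List (V × V)
          qs = map orient (A .pairs)

          qs-oriented : All Oriented qs
          qs-oriented = All.map⁺ (All.map orient-oriented (A .mates))

          qs-joined : AllPairs Joined qs
          qs-joined = AllPairs.map⁺ (AllPairs.map (λ {p} {q} pq {_} {_} u∈ v∈ → pq (∈-orient⁻ p u∈) (∈-orient⁻ q v∈)) (A .pairs-joined))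

          single~q : ∀ {u q v} → u ∈ A .singles → q ∈ qs → v ∈ᵖ q → u ~ v
          single~q u∈ q∈ v∈ with ∈-map⁻ orient q∈
          ... | p , p∈ , refl = A .singles-joined u∈ p∈ (∈-orient⁻ p v∈)

          record Flipped (x : V) (q : V × V) : Set where
            field
              oriented : Oriented q
              ~x       : proj₁ q ~ x
              ≁x       : proj₂ q ≁ x
          open Flipped

          -- The pairs on which x₁ and x have different non-neighbours.  Three flips
          -- would give a forbidden subgraph, and the flips of x₂ and x₂′ exhaust
          -- the pairs, so that there are at most four pairs.
          flips : V → List (V × V)
          flips x = filter (λ q → proj₁ q ~? x) qs

          flips⊆qs : ∀ {x q} → q ∈ flips x → q ∈ qs
          flips⊆qs {x} q∈ = proj₁ (∈-filter⁻ (λ q → proj₁ q ~? x) {xs = qs} q∈)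

          flips-flipped : ∀ {x} → D c a b x → All (Flipped x) (flips x)
          flips-flipped {x} Dx = All.tabulate λ {q} q∈ →
            let (q∈qs , y~x) = ∈-filter⁻ (λ q → proj₁ q ~? x) {xs = qs} q∈
                o = All.lookup qs-oriented q∈qs ; (Dy , Dy′ , yy′) = mated o
            in record { oriented = o ; ~x = y~x
                      ; ≁x = D-apart Dy′ Dx , λ y′~x → not-both-adjacent B Dy Dy′ yy′ Dx y~x y′~x }

          flips-joined : ∀ {x} → AllPairs Joined (flips x)
          flips-joined {x} = AllPairs.filter⁺ (λ q → proj₁ q ~? x) qs-joined

          -- By `not-starred`, the first end of every pair is adjacent to `x₂` or to `x₂′`.
          excess≤flips : excess A ≤ length (flips x₂) + length (flips x₂′)
          excess≤flips = subst (_≤ length (flips x₂) + length (flips x₂′)) (length-map orient (A .pairs))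
            (length-filter-⊎ (λ q → proj₁ q ~? x₂) (λ q → proj₁ q ~? x₂′) qs λ q∈ →
              covered (mated (All.lookup qs-oriented q∈)))
            where
            covered : ∀ {q} → Mates (D a b c) q → proj₁ q ~ x₂ ⊎ proj₁ q ~ x₂′
            covered {y , y′} (Dy , Dy′ , yy′) with y ~? x₂ | y ~? x₂′
            ... | yes yx | _ = inj₁ yx
            ... | no _ | yes yx′ = inj₂ yx′
            ... | no ¬yx | no ¬yx′ = ⊥-elim (not-starred B Dy Dy′ yy′ D₂ D₂′ x₂x₂′
                      (D-apart Dy D₂ , ¬yx) (D-apart Dy D₂′ , ¬yx′))

          -- For three flips `p`, `q`, `r`, the second ends of `q` and `r` form with `x` a path of
          -- `≁`, joined to the pair of `x₁` and the first end of `p`.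
          flips≤2 : ∀ {x} → x₁ ~ x → ∀ {fs} → All (Flipped x) fs → AllPairs Joined fs → length fs ≤ 2
          flips≤2 _ [] _ = z≤n
          flips≤2 _ (_ ∷ []) _ = s≤s z≤n
          flips≤2 _ (_ ∷ _ ∷ []) _ = s≤s (s≤s z≤n)
          flips≤2 x₁x (p ∷ q ∷ r ∷ _) ((pq ∷ pr ∷ _) ∷ (qr ∷ _) ∷ _) = ⊥-elim (P₃∪P₂-free
            (≁-sym (≁x₁ (oriented p))) (≁x q) (≁-sym (≁x r)) (qr (inj₂ refl) (inj₂ refl))
            (~-sym (~x₁ (oriented q)) , x₁x , ~-sym (~x₁ (oriented r)))
            (pq (inj₁ refl) (inj₂ refl) , ~x p , pr (inj₁ refl) (inj₂ refl)))

          -- A vertex `u` on which `x₁` and `x` disagree takes the part of the third flip in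
          -- `flips≤2`. For the second implication `x₁` and `x` change roles, and so do the two ends
          -- of each pair.
          single-agrees : ∀ {x u p q} → D c a b x → x₁ ~ x → u ∈ A .singles → p ∈ qs → q ∈ qs →
            Flipped x p → Flipped x q → Joined p q → (u ~ x₁ → u ~ x) × (u ~ x → u ~ x₁)
          single-agrees Dx x₁x u∈ p∈ q∈ p q pq =
            (λ ux₁ → ¬≁⇒~ (D-apart Du Dx) λ ux → P₃∪P₂-free
              (≁-sym (≁x₁ (oriented p))) (≁x q) (≁-sym ux) (~-sym (u~q (inj₂ refl)))
              (~-sym (~x₁ (oriented q)) , x₁x , ~-sym ux₁)
              (pq (inj₁ refl) (inj₂ refl) , ~x p , ~-sym (u~p (inj₁ refl))))
            , (λ ux → ¬≁⇒~ (D-apart Du D₁) λ ux₁ → P₃∪P₂-free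
              (≁-sym (≁x p)) (≁x₁ (oriented q)) (≁-sym ux₁) (~-sym (u~q (inj₁ refl)))
              (~-sym (~x q) , ~-sym x₁x , ~-sym ux)
              (pq (inj₂ refl) (inj₁ refl) , ~x₁ (oriented p) , ~-sym (u~p (inj₂ refl))))
            where
            Du = All.lookup (A .alone) u∈
            u~p = λ {v} → single~q {v = v} u∈ p∈
            u~q = λ {v} → single~q {v = v} u∈ q∈

          -- A single vertex adjacent to `x₁` is adjacent to `x`, hence not to `x′`; two of these
          -- would form with `x′` a path of `≁` joined to the pair of `x₁` and the first end of `p`.
          -- Those adjacent to `x′` are handled alike. By `starred⇒HasCore` a lone vertex is
          -- adjacent to `x` or to `x′`, which leaves at most two.
          module Mixed {x x′} (Dx : D c a b x) (Dx′ : D c a b x′) (xx′ : x ≁ x′) (x₁x : x₁ ~ x) (x₁x′ : x₁ ~ x′)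
            (agree : ∀ {u} → u ∈ A .singles → (u ~ x₁ → u ~ x) × (u ~ x → u ~ x₁))
            {p} (p∈ : p ∈ qs) (fp : Flipped x′ p) where

            misses-x′ : ∀ {u} → u ∈ A .singles → u ~ x₁ → u ≁ x′
            misses-x′ u∈ ux₁ = D-apart Du Dx′ , λ ux′ →
              not-both-adjacent (reverseᴮ B) (D-swap Dx) (D-swap Dx′) xx′ (D-swap Du) (~-sym (proj₁ (agree u∈) ux₁)) (~-sym ux′)
              where Du = All.lookup (A .alone) u∈

            misses-x₁ : ∀ {u} → u ∈ A .singles → u ~ x′ → u ≁ x₁
            misses-x₁ u∈ ux′ = D-apart (All.lookup (A .alone) u∈) D₁ , λ ux₁ → ≁⇒¬~ (misses-x′ u∈ ux₁) ux′

            near₁≤1 : ∀ {us} → Clique us → All (λ u → u ∈ A .singles × u ~ x₁) us → length us ≤ 1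
            near₁≤1 _ [] = z≤n
            near₁≤1 _ (_ ∷ []) = s≤s z≤n
            near₁≤1 ((uv ∷ _) ∷ _) ((u∈ , ux₁) ∷ (v∈ , vx₁) ∷ _) = ⊥-elim (P₃∪P₂-free
              (≁-sym (≁x₁ (oriented fp))) (misses-x′ u∈ ux₁) (≁-sym (misses-x′ v∈ vx₁)) uv
              (~-sym ux₁ , x₁x′ , ~-sym vx₁)
              (~-sym (single~q u∈ p∈ (inj₁ refl)) , ~x fp , ~-sym (single~q v∈ p∈ (inj₁ refl))))

            near-x′≤1 : ∀ {us} → Clique us → All (λ u → u ∈ A .singles × u ~ x′) us → length us ≤ 1
            near-x′≤1 _ [] = z≤n
            near-x′≤1 _ (_ ∷ []) = s≤s z≤n
            near-x′≤1 ((uv ∷ _) ∷ _) ((u∈ , ux′) ∷ (v∈ , vx′) ∷ _) = ⊥-elim (P₃∪P₂-free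
              (≁-sym (≁x fp)) (misses-x₁ u∈ ux′) (≁-sym (misses-x₁ v∈ vx′)) uv
              (~-sym ux′ , ~-sym x₁x′ , ~-sym vx′)
              (~-sym (single~q u∈ p∈ (inj₂ refl)) , ~x₁ (oriented fp) , ~-sym (single~q v∈ p∈ (inj₂ refl))))

            lone≤2 : length lone ≤ 2
            lone≤2 = ≤-trans (length-filter-⊎ (_~? x₁) (_~? x′) lone near)
              (+-mono-≤
                (near₁≤1 (AllPairs.filter⁺ (_~? x₁) lone-clique) (All.tabulate λ u∈ → sub (_~? x₁) u∈))
                (near-x′≤1 (AllPairs.filter⁺ (_~? x′) lone-clique) (All.tabulate λ u∈ → sub (_~? x′) u∈)))
              where
              lone-clique : Clique lone
              lone-clique = AllPairs.filter⁺ (λ u → ¬? (hasCore? u)) (A .singles-clique)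
              sub : ∀ {P : V → Set} (P? : Decidable P) {u} → u ∈ filter P? lone → u ∈ A .singles × P u
              sub P? u∈ = let (u∈lone , Pu) = ∈-filter⁻ P? {xs = lone} u∈ in proj₁ (lone⁻ u∈lone) , Pu
              near : ∀ {u} → u ∈ lone → u ~ x₁ ⊎ u ~ x′
              near {u} u∈ with lone⁻ u∈ | u ~? x′ | u ~? x
              ... | _ | yes ux′ | _ = inj₂ ux′
              ... | u∈A , _ | no _ | yes ux = inj₁ (proj₂ (agree u∈A) ux)
              ... | u∈A , none | no ¬ux′ | no ¬ux = ⊥-elim (none (starred⇒HasCore B Du Dx Dx′ xx′
                      (D-apart Du Dx , ¬ux) (D-apart Du Dx′ , ¬ux′)))
                where Du = All.lookup (A .alone) u∈A

          -- A single vertex adjacent to `x₁` would be adjacent to both `x₂` and `x₂′`, which is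
          -- impossible. So it is adjacent to neither of these, and `starred⇒HasCore` applies.
          all-attached : (∀ {u} → u ∈ A .singles → (u ~ x₁ → u ~ x₂) × (u ~ x₂ → u ~ x₁)) →
                         (∀ {u} → u ∈ A .singles → (u ~ x₁ → u ~ x₂′) × (u ~ x₂′ → u ~ x₁)) →
                         All HasCore (A .singles)
          all-attached agree agree′ = All.tabulate has
            where
            has : ∀ {u} → u ∈ A .singles → HasCore u
            has {u} u∈ = starred⇒HasCore B Du D₂ D₂′ x₂x₂′
              (D-apart Du D₂ , λ ux₂ → far (proj₂ (agree u∈) ux₂)) (D-apart Du D₂′ , λ ux₂′ → far (proj₂ (agree′ u∈) ux₂′))
              where
              Du = All.lookup (A .alone) u∈
              far : ¬ u ~ x₁
              far ux₁ = not-both-adjacent (reverseᴮ B) (D-swap D₂) (D-swap D₂′) x₂x₂′ (D-swap Du)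
                (~-sym (proj₁ (agree u∈) ux₁)) (~-sym (proj₁ (agree′ u∈) ux₁))

          -- Each of `x₂` and `x₂′` has at most two flips. If both have two, all singles agree on
          -- both and are attached; if one has two and the other has one, there are at most three
          -- pairs and `Mixed` bounds the lone vertices.
          structure : 3 ≤ excess A →
            excess A ≤ 4 × (All HasCore (A .singles) ⊎ excess A ≤ 3 × length lone ≤ 2)
          structure 3≤ = by-flips _ _ refl refl (flips-flipped D₂) (flips-flipped D₂′) flips-joined flips-joined
                                     (≤-trans 3≤ excess≤flips) excess≤flips
            where
            in-qs : ∀ {x q fs} → fs ≡ flips x → q ∈ fs → q ∈ qs
            in-qs refl = flips⊆qs

            by-flips : ∀ fs gs → fs ≡ flips x₂ → gs ≡ flips x₂′ →
              All (Flipped x₂) fs → All (Flipped x₂′) gs → AllPairs Joined fs → AllPairs Joined gs →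
              3 ≤ length fs + length gs → excess A ≤ length fs + length gs →
              excess A ≤ 4 × (All HasCore (A .singles) ⊎ excess A ≤ 3 × length lone ≤ 2)
            by-flips [] gs _ _ _ g _ gj 3≤gs _ = ⊥-elim (<⇒≱ 3≤gs (flips≤2 x₁~x₂′ g gj))
            by-flips fs [] _ _ f _ fj _ 3≤fs _ = ⊥-elim (<⇒≱ (subst (3 ≤_) (+-comm (length fs) 0) 3≤fs) (flips≤2 x₁~x₂ f fj))
            by-flips (_ ∷ []) (_ ∷ []) _ _ _ _ _ _ (s≤s (s≤s ())) _
            by-flips (f ∷ []) (g ∷ g′ ∷ []) f≡ g≡ (Ff ∷ _) (Fg ∷ Fg′ ∷ _) _ ((gg′ ∷ _) ∷ _) _ ≤3 =
              ≤-trans ≤3 (n≤1+n 3) , inj₂ (≤3 , Mixed.lone≤2 D₂′ D₂ (≁-sym x₂x₂′) x₁~x₂′ x₁~x₂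
                (λ u∈ → single-agrees D₂′ x₁~x₂′ u∈ (in-qs g≡ (here refl)) (in-qs g≡ (there (here refl))) Fg Fg′ gg′)
                (in-qs f≡ (here refl)) Ff)
            by-flips (f ∷ f′ ∷ []) (g ∷ []) f≡ g≡ (Ff ∷ Ff′ ∷ _) (Fg ∷ _) ((ff′ ∷ _) ∷ _) _ _ ≤3 =
              ≤-trans ≤3 (n≤1+n 3) , inj₂ (≤3 , Mixed.lone≤2 D₂ D₂′ x₂x₂′ x₁~x₂ x₁~x₂′
                (λ u∈ → single-agrees D₂ x₁~x₂ u∈ (in-qs f≡ (here refl)) (in-qs f≡ (there (here refl))) Ff Ff′ ff′)
                (in-qs g≡ (here refl)) Fg)
            by-flips (f ∷ f′ ∷ []) (g ∷ g′ ∷ []) f≡ g≡ (Ff ∷ Ff′ ∷ _) (Fg ∷ Fg′ ∷ _) ((ff′ ∷ _) ∷ _) ((gg′ ∷ _) ∷ _) _ ≤4 =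
              ≤4 , inj₁ (all-attached
                (λ u∈ → single-agrees D₂ x₁~x₂ u∈ (in-qs f≡ (here refl)) (in-qs f≡ (there (here refl))) Ff Ff′ ff′)
                (λ u∈ → single-agrees D₂′ x₁~x₂′ u∈ (in-qs g≡ (here refl)) (in-qs g≡ (there (here refl))) Fg Fg′ gg′))
            by-flips (_ ∷ _ ∷ _ ∷ _) _ _ _ f _ fj _ _ _ = ⊥-elim (<⇒≱ (s≤s (s≤s (s≤s z≤n))) (flips≤2 x₁~x₂ f fj))
            by-flips _ (_ ∷ _ ∷ _ ∷ _) _ _ _ g _ gj _ _ = ⊥-elim (<⇒≱ (s≤s (s≤s (s≤s z≤n))) (flips≤2 x₁~x₂′ g gj))

      -- Bounds for one D when another has at least two pairs.

      record TwoMates (X : V → Set) : Set where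
        field
          {x₁ x₁′ x₂ x₂′} : V
          in₁  : X x₁
          in₁′ : X x₁′
          mates₁ : x₁ ≁ x₁′
          in₂  : X x₂
          in₂′ : X x₂′
          mates₂ : x₂ ≁ x₂′
          x₁~x₂  : x₁ ~ x₂
          x₁~x₂′ : x₁ ~ x₂′

      two-mates : ∀ {X ps} → 2 ≤ length ps → All (Mates X) ps → AllPairs Joined ps → TwoMates X
      two-mates (s≤s (s≤s z≤n)) ((X₁ , X₁′ , m₁) ∷ (X₂ , X₂′ , m₂) ∷ _) ((J ∷ _) ∷ _) = record
        { in₁ = X₁ ; in₁′ = X₁′ ; mates₁ = m₁ ; in₂ = X₂ ; in₂′ = X₂′ ; mates₂ = m₂
        ; x₁~x₂ = J (inj₁ refl) (inj₁ refl) ; x₁~x₂′ = J (inj₁ refl) (inj₂ refl) }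

      module _ {a b c} (B : Base a b c) (A : Split (D a b c)) (C : Split (D c a b)) (2≤C : 2 ≤ excess C) where

        open TwoMates (two-mates 2≤C (C .mates) (C .pairs-joined))

        τ-bound : 2 + (τ + excess A) ≤ w
        τ-bound = core-bound B A in₁ in₁′ mates₁

        excess-structure : 3 ≤ excess A →
          excess A ≤ 4 × (All HasCore (A .singles) ⊎ excess A ≤ 3 × length (lone B A) ≤ 2)
        excess-structure = TwoPairs.structure B A in₁ in₁′ mates₁ in₂ in₂′ mates₂ x₁~x₂ x₁~x₂′

        excess≤4 : excess A ≤ 4
        excess≤4 with 3 ≤? excess A
        ... | yes 3≤ = proj₁ (excess-structure 3≤)
        ... | no 3≰ = ≤-trans (≮⇒≥ 3≰) (s≤s (s≤s z≤n))

        saturated : 4 ≤ excess A → All HasCore (A .singles)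
        saturated 4≤ with proj₂ (excess-structure (≤-trans (n≤1+n 3) 4≤))
        ... | inj₁ has       = has
        ... | inj₂ (≤3 , _) = ⊥-elim (<⇒≱ 4≤ ≤3)

      -- Vertices without a non-neighbour in `Core` are adjacent to all of it, so `U` fits into
      -- `big-clique`. With the partners of the attached vertices as `Z`, the clique counts those
      -- vertices without containing them; with all of `Core` it bounds `τ`.
      attached-bound : ∀ {a b c x x′ U} (B : Base a b c) (A : Split (D a b c)) → D c a b x → D c a b x′ → x ≁ x′ →
        Clique U → All (_∈ A .singles) U → All (_~ x) U → All (¬_ ∘ HasCore) U →
        2 + (length (attached B A) + (length U + excess A)) ≤ w × 2 + (τ + (length U + excess A)) ≤ w
      attached-bound {U = U} B A Dx Dx′ xx′ U-clique U⊆ U~x U-lone with attached-partners B A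
      ... | Z , |Z|≡ , Z-core , Z-clique =
        subst (λ k → 2 + (k + (length U + excess A)) ≤ w) |Z|≡ (clique-with Z-clique Z-core)
        , clique-with (cores-clique B) all-Core
        where
        clique-with : ∀ {Z} → Clique Z → All Core Z → 2 + (length Z + (length U + excess A)) ≤ w
        clique-with Z-clique Z-core = big-clique B A Dx Dx′ xx′ Z-clique Z-core U-clique U⊆ U~x
          λ z∈ u∈ → let Ct = All.lookup Z-core z∈ ; Du = All.lookup (A .alone) (All.lookup U⊆ u∈) in
            ¬≁⇒~ (separated (proj₁ (B .Core⊆T Ct)) (proj₁ Du)) λ zu → All.lookup U-lone u∈ (_ , Ct , zu)

      filter-empty : ∀ {P : V → Set} (P? : Decidable P) {xs} → All P xs → length (filter (λ v → ¬? (P? v)) xs) ≡ 0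
      filter-empty P? [] = refl
      filter-empty P? {x ∷ xs} (px ∷ pxs) with P? x
      ... | yes _ = filter-empty P? pxs
      ... | no ¬p = ⊥-elim (¬p px)

      -- The second alternative allows one vertex more and pays for it with a smaller `Core`;
      -- `small-sum` shows that the trade suffices.
      Small : ℕ → Set
      Small d = d ≤ 1 + w ⊎ d ≤ 2 + w × 6 + τ ≤ w

      mono-rearranged : ∀ {a b c d l r} → a ≤ b → c ≤ d → l ≡ a + c → b + d ≡ r → l ≤ r
      mono-rearranged a≤b c≤d refl refl = +-mono-≤ a≤b c≤d

      lone-total : ∀ {s k q w} → s ≤ k + 2 → 2 + (k + (1 + q)) ≤ w → q ≤ 3 → s + q + q ≤ 2 + w
      lone-total {s} {k} {q} {w} s≤ k≤ q≤3 = ≤-trans (+-monoˡ-≤ q (+-monoˡ-≤ q s≤))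
        (+-cancelˡ-≤ 1 _ _ (mono-rearranged k≤ q≤3 (rearrange k q) (+-comm w 3)))
        where
        rearrange : ∀ k q → 1 + ((k + 2 + q) + q) ≡ 2 + (k + (1 + q)) + q
        rearrange = solve-∀

      lone-core : ∀ {t q w} → 2 + (t + (1 + q)) ≤ w → 3 ≤ q → 6 + t ≤ w
      lone-core {t} t≤ 3≤q = ≤-trans (≤-reflexive (rearrange t)) (≤-trans (+-monoʳ-≤ 2 (+-monoʳ-≤ t (s≤s 3≤q))) t≤)
        where
        rearrange : ∀ t → 6 + t ≡ 2 + (t + 4)
        rearrange = solve-∀

      -- With at most two pairs, `parts-bound` gives 1 + w. With three or four pairs and no lone
      -- vertices, `attached-bound` gives at most w - 2 parts, so the total is at most w - 2 plus
      -- the number of pairs. Otherwise there are three pairs and at most two lone vertices, and a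
      -- lone vertex adjacent to an end of a pair in `C` enlarges both cliques of `attached-bound`.
      total-small : ∀ {a b c} → Base a b c → (A : Split (D a b c)) → (C : Split (D c a b)) → 2 ≤ excess C → Small (total A)
      total-small {a} {b} {c} B A C 2≤C = by-excess (3 ≤? excess A)
        where
        open TwoMates (two-mates 2≤C (C .mates) (C .pairs-joined))

        q att : ℕ
        q = excess A
        att = length (attached B A)

        singles-bound : length (lone B A) ≡ 0 → 2 + (length (A .singles) + q) ≤ w
        singles-bound none = ≤-trans (s≤s (s≤s (+-monoˡ-≤ q (≤-trans (singles≤ B A)
          (≤-reflexive (trans (cong (att +_) none) (+-comm att 0)))))))
          (proj₁ (attached-bound B A in₁ in₁′ mates₁ [] [] [] []))

        without-lone : length (lone B A) ≡ 0 → q ≤ 3 → Small (total A)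
        without-lone none ≤3 = inj₁ (+-cancelˡ-≤ 2 _ _ (mono-rearranged (singles-bound none) ≤3 refl (+-comm w 3)))

        all-attached : All HasCore (A .singles) → q ≤ 4 → Dec (q ≤ 3) → Small (total A)
        all-attached has _ (yes ≤3) = without-lone (filter-empty hasCore? has) ≤3
        all-attached has ≤4 (no ≰3) = inj₂
          ( +-cancelˡ-≤ 2 _ _ (mono-rearranged (singles-bound (filter-empty hasCore? has)) ≤4 refl (+-comm w 4))
          , ≤-trans (≤-reflexive (rearrange τ)) (≤-trans (+-monoʳ-≤ 2 (+-monoʳ-≤ τ (≰⇒> ≰3))) (τ-bound B A C 2≤C)))
          where
          rearrange : ∀ t → 6 + t ≡ 2 + (t + 4)
          rearrange = solve-∀

        with-lone : ∀ {x x′ u} → D c a b x → D c a b x′ → x ≁ x′ → u ∈ lone B A → u ~ x →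
                    length (lone B A) ≤ 2 → 3 ≤ q → q ≤ 3 → Small (total A)
        with-lone Dx Dx′ xx′ u∈ ux lone≤2 3≤ ≤3 = inj₂
          ( lone-total {length (A .singles)} {att} {q} {w} (≤-trans (singles≤ B A) (+-monoʳ-≤ att lone≤2)) (proj₁ bounds) ≤3
          , lone-core {τ} {q} {w} (proj₂ bounds) 3≤)
          where
          bounds = attached-bound B A Dx Dx′ xx′ ([] ∷ []) (proj₁ (lone⁻ B A u∈) ∷ []) (ux ∷ []) (proj₂ (lone⁻ B A u∈) ∷ [])

        few-lone : ∀ us → (∀ {u} → u ∈ us → u ∈ lone B A) → length us ≡ length (lone B A) →
                   length (lone B A) ≤ 2 → 3 ≤ q → q ≤ 3 → Small (total A)
        few-lone [] _ none _ _ ≤3 = without-lone (sym none) ≤3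
        few-lone (u ∷ _) ⊆lone _ lone≤2 3≤ ≤3 with ⊆lone (here refl) | u ~? x₁ | u ~? x₁′
        ... | u∈ | yes ux₁ | _ = with-lone in₁ in₁′ mates₁ u∈ ux₁ lone≤2 3≤ ≤3
        ... | u∈ | no _ | yes ux₁′ = with-lone in₁′ in₁ (≁-sym mates₁) u∈ ux₁′ lone≤2 3≤ ≤3
        ... | u∈ | no ¬ux₁ | no ¬ux₁′ with lone⁻ B A u∈
        ...   | u∈A , none = ⊥-elim (none (starred⇒HasCore B Du in₁ in₁′ mates₁
                (D-apart Du in₁ , ¬ux₁) (D-apart Du in₁′ , ¬ux₁′)))
          where Du = All.lookup (A .alone) u∈A

        by-excess : Dec (3 ≤ q) → Small (total A)
        by-excess (no 3≰) = inj₁ (+-cancelˡ-≤ 1 _ _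
          (mono-rearranged (parts-bound A (proj₁ ∘ proj₂)) (≮⇒≥ 3≰) refl (+-comm w 2)))
        by-excess (yes 3≤) with excess-structure B A C 2≤C 3≤
        ... | ≤4 , inj₁ has             = all-attached has ≤4 (q ≤? 3)
        ... | _  , inj₂ (≤3 , lone≤2) = few-lone (lone B A) id refl lone≤2 3≤ ≤3

      -- Colourings around a stable triple.

      side-cover : ∀ {a b c Y} → Triangle a b c → Clique Y → (∀ {v} → v ∈ Y → v ~ a × (v ~ b ⊎ v ~ c)) →
                   Cover (λ v → v ∈ Ns a b c ⊎ v ∈ Y) (pred w)
      side-cover {a} {b} {c} {Y} tri Y-clique Y⊆ = two-clique-cover (pred w) (N-clique tri) Y-clique
        (λ x∈ y∈ → apart (∈-listOf⁻ (N? a b c) x∈) (proj₂ (Y⊆ y∈)))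
        -- All of `Z` is adjacent to `a`, which can therefore be added to the clique; this leaves w
        -- - 1 for `Z`.
        λ {Z} Z-clique Z⊆ → pred-mono-≤ (clique≤ω {xs = a ∷ Z} (All.map (~-sym ∘ ~a) Z⊆ ∷ Z-clique))
        where
        apart : ∀ {x y} → N a b c x → y ~ b ⊎ y ~ c → x ≢ y
        apart (_ , xb , _) (inj₁ yb) = separated yb xb ∘ sym
        apart (_ , _ , xc) (inj₂ yc) = separated yc xc ∘ sym
        ~a : ∀ {v} → v ∈ Ns a b c ⊎ v ∈ Y → v ~ a
        ~a (inj₁ v∈) = proj₁ (∈-listOf⁻ (N? a b c) v∈)
        ~a (inj₂ v∈) = proj₁ (Y⊆ v∈)

      -- The colours are one for the corners, `e` for `Between a c`, at most w - 1 for `Ns b c a`,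
      -- `k` for the vertices removed from the pairs of `A` and `C`, and w - 1 for each use of
      -- `side-cover`, on `Ns a b c` with the rest of `D c a b` and on `Ns c a b` with the rest of
      -- `D a b c`. The last hypothesis brings the sum 3w - 2 + e + k to at most 4w.
      χ-bound : ∀ {a b c e k} → Base a b c → (A : Split (D a b c)) (C : Split (D c a b)) → Cover (Between a c) e →
                excess A ≤ k → excess C ≤ k → suc e + k ≤ 3 + w → χ G ≤ 4 * w
      χ-bound {a} {b} {c} {e} {k} B A C E A≤k C≤k e+k≤
        with share k (C .pairs) (A .pairs) C≤k A≤k missing
        where
        missing : ∀ {p q} → p ∈ C .pairs → q ∈ A .pairs → proj₁ p ≁ proj₁ q ⊎ proj₁ p ≁ proj₂ q
        missing {x , _} {y , y′} p∈ q∈ with All.lookup (C .mates) p∈ | All.lookup (A .mates) q∈ | y ~? x | y′ ~? x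
        ... | Dx , _ | Dy , _ , _ | no ¬yx | _ = inj₁ (≁-sym (D-apart Dy Dx , ¬yx))
        ... | Dx , _ | _ , Dy′ , _ | yes _ | no ¬y′x = inj₂ (≁-sym (D-apart Dy′ Dx , ¬y′x))
        ... | Dx , _ | Dy , Dy′ , yy′ | yes yx | yes y′x = ⊥-elim (not-both-adjacent B Dy Dy′ yy′ Dx yx y′x)
      ... | vs , rs , tr , leftover , shared = Cover⇒χ≤ (Cover-map (λ {v} _ → sort v) size≤
            (one-class _ (corners-stable (B .tri)) ⊕ E ⊕ singletons (Ns b c a) ⊕ shared
             ⊕ side-cover (B .tri) (split-clique C (seconds _)) (C⊆ ∘ All.lookup (split-clique⊆ C (seconds _)))
             ⊕ side-cover (rotate (rotate (B .tri))) (split-clique A tr) (A⊆ ∘ All.lookup (split-clique⊆ A tr))))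
        where
        C⊆ : ∀ {v} → D c a b v → v ~ a × (v ~ b ⊎ v ~ c)
        C⊆ (_ , va , vb) = va , inj₁ vb
        A⊆ : ∀ {v} → D a b c v → v ~ c × (v ~ a ⊎ v ~ b)
        A⊆ (_ , vb , vc) = vc , inj₂ vb

        sort : ∀ v → v ∈ a ∷ b ∷ c ∷ [] ⊎ Between a c v ⊎ v ∈ Ns b c a ⊎ (v ∈ map proj₁ (C .pairs) ⊎ v ∈ rs) ⊎
                     (v ∈ Ns a b c ⊎ v ∈ C .singles ++ map proj₂ (C .pairs)) ⊎ (v ∈ Ns c a b ⊎ v ∈ A .singles ++ vs)
        sort v with position (B .tri) v
        ... | corner v∈ = inj₁ v∈
        ... | inNa v∈ = inj₂ (inj₂ (inj₂ (inj₂ (inj₁ (inj₁ (∈-listOf⁺ (N? a b c) v∈))))))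
        ... | inNb v∈ = inj₂ (inj₂ (inj₁ (∈-listOf⁺ (N? b c a) v∈)))
        ... | inNc v∈ = inj₂ (inj₂ (inj₂ (inj₂ (inj₂ (inj₁ (∈-listOf⁺ (N? c a b) v∈))))))
        ... | inT (va , _ , vc) = inj₂ (inj₁ (va , vc))
        ... | inDb (_ , vc , va) = inj₂ (inj₁ (va , vc))
        ... | inDa v∈ with A .exhausts v∈
        ...   | inj₁ v∈A = inj₂ (inj₂ (inj₂ (inj₂ (inj₂ (inj₂ (∈-++⁺ˡ v∈A))))))
        ...   | inj₂ v∈p = [ (λ v∈vs → inj₂ (inj₂ (inj₂ (inj₂ (inj₂ (inj₂ (∈-++⁺ʳ (A .singles) v∈vs)))))))
                           , (λ v∈rs → inj₂ (inj₂ (inj₂ (inj₁ (inj₂ v∈rs))))) ]′ (leftover v∈p)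
        sort v | inDc v∈ with C .exhausts v∈
        ...   | inj₁ v∈C = inj₂ (inj₂ (inj₂ (inj₂ (inj₁ (inj₂ (∈-++⁺ˡ v∈C))))))
        ...   | inj₂ v∈p with find v∈p
        ...     | p , p∈ , inj₁ refl = inj₂ (inj₂ (inj₂ (inj₁ (inj₁ (∈-map⁺ proj₁ p∈)))))
        ...     | p , p∈ , inj₂ refl = inj₂ (inj₂ (inj₂ (inj₂ (inj₁ (inj₂ (∈-++⁺ʳ (C .singles) (∈-map⁺ proj₂ p∈)))))))

        m nb : ℕ
        m = pred w
        nb = length (Ns b c a)
        suc-m≤w : suc m ≤ w
        suc-m≤w = suc-pred-≤ (N-bound (B .tri))
          where
          suc-pred-≤ : ∀ {j k} → suc j ≤ k → suc (pred k) ≤ k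
          suc-pred-≤ (s≤s _) = ≤-refl
        size≤ : 1 + (e + (nb + (k + (m + m)))) ≤ 4 * w
        size≤ = +-cancelˡ-≤ 3 _ _ (subst₂ _≤_ (lhs e nb k m) (rhs w)
          (+-mono-≤ e+k≤ (+-mono-≤ (N-bound (rotate (B .tri))) (+-mono-≤ suc-m≤w suc-m≤w))))
          where
          lhs : ∀ e nb k m → suc e + k + (suc nb + (suc m + suc m)) ≡ 3 + (1 + (e + (nb + (k + (m + m)))))
          lhs = solve-∀
          rhs : ∀ w → 3 + w + (w + (w + w)) ≡ 3 + 4 * w
          rhs = solve-∀

      -- By `parts-bound`, w - 1 colours suffice for `Between a c`, which leaves room for three
      -- classes of removed vertices.
      χ-few : ∀ {a b c k} → Base a b c → (A : Split (D a b c)) (C : Split (D c a b)) →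
              excess A ≤ k → excess C ≤ k → k ≤ 3 → χ G ≤ 4 * w
      χ-few {k = k} B A C A≤k C≤k k≤3 = χ-bound B A C (split-cover E) A≤k C≤k
        (≤-trans (+-mono-≤ (parts-bound E proj₁) k≤3) (≤-reflexive (+-comm w 3)))
        where E = between-split (≁-sym (Triangle.ca (B .tri)))

      -- By `core-matching`, each vertex of `Core` shares its class with at most one non-neighbour
      -- in `D a b c`. Every single vertex has such a partner, so the singles need no colours of
      -- their own.
      saturated-cover : ∀ {a b c} → Base a b c → (A : Split (D a b c)) → All HasCore (A .singles) →
                        Cover (λ v → v ~ b × v ~ c) (τ + excess A)
      saturated-cover {a} {b} {c} B A has = Cover-map sort ≤-refl
        (map-cover {X = λ v → Any (λ t → v ∈ class t) Cores} class Cores (All.tabulate (class-stable ∘ ∈-listOf⁻ core?)) id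
        ⊕ map-cover {X = λ v → Any (λ p → v ∈ proj₁ p ∷ proj₂ p ∷ []) (A .pairs)} (λ p → proj₁ p ∷ proj₂ p ∷ []) (A .pairs)
            (All.map (λ (_ , _ , uv) {u} {v} → stable-[x,y] uv {u} {v}) (A .mates)) id)
        where
        class : V → List V
        class t = t ∷ filter (t ≁?_) (Ds a b c)

        ∈-class⁻ : ∀ {t v} → v ∈ filter (t ≁?_) (Ds a b c) → D a b c v × t ≁ v
        ∈-class⁻ {t} v∈ with ∈-filter⁻ (t ≁?_) {xs = Ds a b c} v∈
        ... | v∈D , tv = ∈-listOf⁻ (D? a b c) v∈D , tv

        class-stable : ∀ {t} → Core t → Stable (class t)
        class-stable {t} _ (here refl) (here refl) = irrefl G t
        class-stable _ (here refl) (there v∈) = ≁⇒¬~ (proj₂ (∈-class⁻ v∈))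
        class-stable _ (there u∈) (here refl) = ≁⇒¬~ (proj₂ (∈-class⁻ u∈)) ∘ ~-sym
        class-stable Ct (there u∈) (there v∈) uv with ∈-class⁻ u∈ | ∈-class⁻ v∈
        ... | Du , tu | Dv , tv = ~⇒≢ uv (core-matching B Ct Du Dv tu tv)

        sort : ∀ {v} → v ~ b × v ~ c → Any (λ t → v ∈ class t) Cores ⊎ Any (λ p → v ∈ proj₁ p ∷ proj₂ p ∷ []) (A .pairs)
        sort {v} (vb , vc) with v ~? a
        ... | yes va = inj₁ (lose (∈-listOf⁺ core? (maximal (B .tri) (B .Core⊆T) (va , vb , vc))) (here refl))
        ... | no ¬va = by-exhaustion (A .exhausts Dv)
          where
          Dv : D a b c v
          Dv = (separated vb (Triangle.ab (B .tri)) , ¬va) , vb , vc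
          by-exhaustion : v ∈ A .singles ⊎ Any (v ∈ᵖ_) (A .pairs) → _
          by-exhaustion (inj₂ v∈) = inj₂ (Any.map [ here , there ∘ here ]′ v∈)
          by-exhaustion (inj₁ v∈) = let (t , Ct , tv) = All.lookup has v∈ in
            inj₁ (lose (∈-listOf⁺ core? Ct) (there (∈-filter⁺ (t ≁?_) (∈-listOf⁺ (D? a b c) Dv) tv)))

      -- The saturated D lies inside `Between a c`, which then needs only w - 2 colours and leaves
      -- room for four classes of removed vertices.
      χ-saturated : ∀ {a b c} → Base a b c → (A : Split (D a b c)) (B′ : Split (D b c a)) (C : Split (D c a b)) →
        excess A ≤ 4 → excess C ≤ 4 → All HasCore (B′ .singles) → 2 + (τ + excess B′) ≤ w → χ G ≤ 4 * w
      χ-saturated B A B′ C A≤4 C≤4 has τ≤ = χ-bound B A C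
        (Cover-map (λ (va , vc) → vc , va) ≤-refl (saturated-cover (rotateᴮ B) B′ has)) A≤4 C≤4
        (≤-trans (≤-reflexive (rearrange (τ + excess B′))) (+-monoʳ-≤ 3 τ≤))
        where
        rearrange : ∀ e → suc e + 4 ≡ 3 + (2 + e)
        rearrange = solve-∀

      -- With at most one pair, `D a b c` and `D c a b` have at most w vertices each. `Between a c`
      -- has at most 2w - 2, and the corners with the three N at most 3w.
      few-excess : ∀ {a b c} → Base a b c → (A : Split (D a b c)) (C : Split (D c a b)) →
                   excess A ≤ 1 → excess C ≤ 1 → Goal
      few-excess {a} {b} {c} B A C A≤1 C≤1 = Listing⇒n≤ (Listing-map (λ {v} _ → sort v) size≤
          (listing (a ∷ b ∷ c ∷ []) ⊞ listing (Ns a b c) ⊞ listing (Ns b c a) ⊞ listing (Ns c a b)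
           ⊞ split-listing E ⊞ split-listing A ⊞ split-listing C))
        , χ-few B A C A≤1 C≤1 (s≤s z≤n)
        where
        E = between-split (≁-sym (Triangle.ca (B .tri)))

        sort : ∀ v → v ∈ a ∷ b ∷ c ∷ [] ⊎ v ∈ Ns a b c ⊎ v ∈ Ns b c a ⊎ v ∈ Ns c a b ⊎ Between a c v ⊎ D a b c v ⊎ D c a b v
        sort v with position (B .tri) v
        ... | corner v∈ = inj₁ v∈
        ... | inNa v∈ = inj₂ (inj₁ (∈-listOf⁺ (N? a b c) v∈))
        ... | inNb v∈ = inj₂ (inj₂ (inj₁ (∈-listOf⁺ (N? b c a) v∈)))
        ... | inNc v∈ = inj₂ (inj₂ (inj₂ (inj₁ (∈-listOf⁺ (N? c a b) v∈))))
        ... | inT (va , _ , vc) = inj₂ (inj₂ (inj₂ (inj₂ (inj₁ (va , vc)))))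
        ... | inDb (_ , vc , va) = inj₂ (inj₂ (inj₂ (inj₂ (inj₁ (va , vc)))))
        ... | inDa v∈ = inj₂ (inj₂ (inj₂ (inj₂ (inj₂ (inj₁ v∈)))))
        ... | inDc v∈ = inj₂ (inj₂ (inj₂ (inj₂ (inj₂ (inj₂ v∈)))))

        total-E : 2 + total E ≤ w + w
        total-E = mono-rearranged (parts-bound E proj₁)
          (≤-trans (s≤s (m≤n+m (excess E) (length (E .singles)))) (parts-bound E proj₁)) (cong suc (sym (+-suc (parts E) (excess E)))) refl

        size≤ : 3 + (length (Ns a b c) + (length (Ns b c a) + (length (Ns c a b) + (total E + (total A + total C))))) ≤ 7 * w
        size≤ = few-total (N-bound (B .tri)) (N-bound (rotate (B .tri))) (N-bound (rotate (rotate (B .tri))))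
          total-E (+-mono-≤ (parts-bound A (proj₁ ∘ proj₂)) A≤1) (+-mono-≤ (parts-bound C (proj₁ ∘ proj₂)) C≤1)
          where
          few-total : ∀ {x y z e f g w} → suc x ≤ w → suc y ≤ w → suc z ≤ w → 2 + e ≤ w + w → suc f ≤ w + 1 → suc g ≤ w + 1 →
                      3 + (x + (y + (z + (e + (f + g))))) ≤ 7 * w
          few-total {x} {y} {z} {e} {f} {g} {w} x≤ y≤ z≤ e≤ f≤ g≤ = ≤-trans (m≤n+m _ 2) (+-cancelˡ-≤ 2 _ _
            (subst₂ _≤_ (lhs x y z e f g) (rhs w)
              (+-mono-≤ x≤ (+-mono-≤ y≤ (+-mono-≤ z≤ (+-mono-≤ e≤ (+-mono-≤ f≤ g≤)))))))
            where
            lhs : ∀ x y z e f g → suc x + (suc y + (suc z + (2 + e + (suc f + suc g)))) ≡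
                                  2 + (2 + (3 + (x + (y + (z + (e + (f + g)))))))
            lhs = solve-∀
            rhs : ∀ w → w + (w + (w + (w + w + (w + 1 + (w + 1))))) ≡ 2 + 7 * w
            rhs = solve-∀

      -- If all three sizes are at most 1 + w, then τ ≤ w - 4 gives 4w - 1. Otherwise one of them
      -- brings τ ≤ w - 6, which absorbs three sizes of at most 2 + w.
      small-sum : ∀ {d e f} → 4 + τ ≤ w → Small d → Small e → Small f → τ + (d + (e + f)) ≤ 4 * w
      small-sum {d} {e} {f} τ≤ sd se sf = by-size sd se sf
        where
        small⇒≤ : ∀ {d} → Small d → d ≤ 2 + w
        small⇒≤ (inj₁ d≤)       = ≤-trans d≤ (n≤1+n _)
        small⇒≤ (inj₂ (d≤ , _)) = d≤

        crude : 6 + τ ≤ w → τ + (d + (e + f)) ≤ 4 * w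
        crude 6+τ≤ = +-cancelˡ-≤ 6 _ _
          (mono-rearranged 6+τ≤ (+-mono-≤ (small⇒≤ sd) (+-mono-≤ (small⇒≤ se) (small⇒≤ sf))) (lhs τ (d + (e + f))) (rhs w))
          where
          lhs : ∀ t d → 6 + (t + d) ≡ 6 + t + d
          lhs = solve-∀
          rhs : ∀ w → w + (2 + w + (2 + w + (2 + w))) ≡ 6 + 4 * w
          rhs = solve-∀

        by-size : Small d → Small e → Small f → τ + (d + (e + f)) ≤ 4 * w
        by-size (inj₂ (_ , 6+τ≤)) _ _ = crude 6+τ≤
        by-size _ (inj₂ (_ , 6+τ≤)) _ = crude 6+τ≤
        by-size _ _ (inj₂ (_ , 6+τ≤)) = crude 6+τ≤
        by-size (inj₁ d≤) (inj₁ e≤) (inj₁ f≤) = ≤-trans (n≤1+n _) (+-cancelˡ-≤ 3 _ _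
          (mono-rearranged τ≤ (+-mono-≤ d≤ (+-mono-≤ e≤ f≤)) (lhs τ (d + (e + f))) (rhs w)))
          where
          lhs : ∀ t d → 3 + suc (t + d) ≡ 4 + t + d
          lhs = solve-∀
          rhs : ∀ w → w + (suc w + (suc w + suc w)) ≡ 3 + 4 * w
          rhs = solve-∀

      many-excess : ∀ {a b c} → Base a b c → (A : Split (D a b c)) (B′ : Split (D b c a)) (C : Split (D c a b)) →
                    2 ≤ excess A → 2 ≤ excess C → Goal
      many-excess {a} {b} {c} B A B′ C 2≤A 2≤C = Listing⇒n≤ (Listing-map (λ {v} _ → sort v) size≤
          (listing (a ∷ b ∷ c ∷ []) ⊞ listing (Ns a b c) ⊞ listing (Ns b c a) ⊞ listing (Ns c a b)
           ⊞ listing Cores ⊞ split-listing A ⊞ split-listing B′ ⊞ split-listing C))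
        , χ≤ (4 ≤? excess A) (4 ≤? excess B′) (4 ≤? excess C)
        where
        B₁ = rotateᴮ B
        B₂ = rotateᴮ B₁
        B⁻ = reverseᴮ B
        A⁻ = split-swap A
        C⁻ = split-swap C

        -- A D with four pairs is saturated and is rotated into the middle position, where
        -- `χ-saturated` applies; if there is none, `χ-few` suffices.
        χ≤ : Dec (4 ≤ excess A) → Dec (4 ≤ excess B′) → Dec (4 ≤ excess C) → χ G ≤ 4 * w
        χ≤ (yes 4≤A) _ _ = χ-saturated B₂ C A B′ (excess≤4 B⁻ C⁻ A⁻ 2≤A) (excess≤4 B₁ B′ A 2≤A)
          (saturated B A C 2≤C 4≤A) (τ-bound B A C 2≤C)
        χ≤ _ (yes 4≤B) _ = χ-saturated B A B′ C (excess≤4 B A C 2≤C) (excess≤4 B⁻ C⁻ A⁻ 2≤A)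
          (saturated B₁ B′ A 2≤A 4≤B) (τ-bound B₁ B′ A 2≤A)
        χ≤ _ _ (yes 4≤C) = χ-saturated B₁ B′ C A (excess≤4 B₁ B′ A 2≤A) (excess≤4 B A C 2≤C)
          (saturated B⁻ C⁻ A⁻ 2≤A 4≤C) (τ-bound B⁻ C⁻ A⁻ 2≤A)
        χ≤ (no 4≰A) _ (no 4≰C) = χ-few B A C (≮⇒≥ 4≰A) (≮⇒≥ 4≰C) ≤-refl

        sort : ∀ v → v ∈ a ∷ b ∷ c ∷ [] ⊎ v ∈ Ns a b c ⊎ v ∈ Ns b c a ⊎ v ∈ Ns c a b ⊎
                     v ∈ Cores ⊎ D a b c v ⊎ D b c a v ⊎ D c a b v
        sort v with position (B .tri) v
        ... | corner v∈ = inj₁ v∈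
        ... | inNa v∈ = inj₂ (inj₁ (∈-listOf⁺ (N? a b c) v∈))
        ... | inNb v∈ = inj₂ (inj₂ (inj₁ (∈-listOf⁺ (N? b c a) v∈)))
        ... | inNc v∈ = inj₂ (inj₂ (inj₂ (inj₁ (∈-listOf⁺ (N? c a b) v∈))))
        ... | inT v∈ = inj₂ (inj₂ (inj₂ (inj₂ (inj₁ (∈-listOf⁺ core? (maximal (B .tri) (B .Core⊆T) v∈))))))
        ... | inDa v∈ = inj₂ (inj₂ (inj₂ (inj₂ (inj₂ (inj₁ v∈)))))
        ... | inDb v∈ = inj₂ (inj₂ (inj₂ (inj₂ (inj₂ (inj₂ (inj₁ v∈))))))
        ... | inDc v∈ = inj₂ (inj₂ (inj₂ (inj₂ (inj₂ (inj₂ (inj₂ v∈))))))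

        4+τ≤w : 4 + τ ≤ w
        4+τ≤w = ≤-trans (≤-reflexive (rearrange τ)) (≤-trans (+-monoʳ-≤ 2 (+-monoʳ-≤ τ 2≤A)) (τ-bound B A C 2≤C))
          where
          rearrange : ∀ t → 4 + t ≡ 2 + (t + 2)
          rearrange = solve-∀

        size≤ : 3 + (length (Ns a b c) + (length (Ns b c a) + (length (Ns c a b) + (τ + (total A + (total B′ + total C)))))) ≤ 7 * w
        size≤ = mono-rearranged₄ (N-bound (B .tri)) (N-bound (rotate (B .tri))) (N-bound (rotate (rotate (B .tri))))
          (small-sum {total A} {total B′} {total C} 4+τ≤w (total-small B A C 2≤C) (total-small B₁ B′ A 2≤A) (total-small B⁻ C⁻ A⁻ 2≤A))
          where
          mono-rearranged₄ : ∀ {x y z r w} → suc x ≤ w → suc y ≤ w → suc z ≤ w → r ≤ 4 * w → 3 + (x + (y + (z + r))) ≤ 7 * w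
          mono-rearranged₄ {x} {y} {z} {r} {w} x≤ y≤ z≤ r≤ = subst₂ _≤_ (lhs x y z r) (rhs w) (+-mono-≤ x≤ (+-mono-≤ y≤ (+-mono-≤ z≤ r≤)))
            where
            lhs : ∀ x y z r → suc x + (suc y + (suc z + r)) ≡ 3 + (x + (y + (z + r)))
            lhs = solve-∀
            rhs : ∀ w → w + (w + (w + 4 * w)) ≡ 7 * w
            rhs = solve-∀

      -- Two of the three D fall on the same side of the threshold, at most one pair or at least
      -- two; a rotation puts them in the first and last positions.
      bounds : ∀ {a b c} → Base a b c → Goal
      bounds B = by-excess (excess A ≤? 1) (excess B′ ≤? 1) (excess C ≤? 1)
        where
        B₁ = rotateᴮ B
        B₂ = rotateᴮ B₁
        A = D-split (B .tri)
        B′ = D-split (B₁ .tri)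
        C = D-split (B₂ .tri)
        by-excess : Dec (excess A ≤ 1) → Dec (excess B′ ≤ 1) → Dec (excess C ≤ 1) → Goal
        by-excess (yes A≤1) (yes B≤1) _ = few-excess B₁ B′ A B≤1 A≤1
        by-excess (yes A≤1) _ (yes C≤1) = few-excess B A C A≤1 C≤1
        by-excess _ (yes B≤1) (yes C≤1) = few-excess B₂ C B′ C≤1 B≤1
        by-excess (no A≰1) (no B≰1) _ = many-excess B₁ B′ C A (≰⇒> B≰1) (≰⇒> A≰1)
        by-excess (no A≰1) _ (no C≰1) = many-excess B A B′ C (≰⇒> A≰1) (≰⇒> C≰1)
        by-excess _ (no B≰1) (no C≰1) = many-excess B₂ C A B′ (≰⇒> C≰1) (≰⇒> B≰1)

  -- The case distinction and the choice of the triple.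

  joined-pair? : Dec (∃ λ x → ∃ λ y → ∃ λ z → ∃ λ u → ∃ λ v → Triangle x y z × u ≁ v × T x y z u × T x y z v)
  joined-pair? = any? λ x → any? λ y → any? λ z → any? λ u → any? λ v →
    triangle? x y z ×-dec (u ≁? v) ×-dec T? x y z u ×-dec T? x y z v

  goal : Goal
  goal with joined-pair?
  ... | yes (_ , _ , _ , _ , _ , tri , uv , Tu , Tv) = JoinedPair.n-bound tri uv Tu Tv , JoinedPair.χ-bound tri uv Tu Tv
  ... | no no-joined-pair with any? (λ x → any? λ y → any? λ z → triangle? x y z)
  ...   | no no-triangle = NoJoined.triangle-free
            (λ tri uv Tu Tv → no-joined-pair (_ , _ , _ , _ , _ , tri , uv , Tu , Tv))
            λ {x} {y} {z} tri → no-triangle (x , y , z , tri)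
  ...   | yes (x , y , z , tri) = from-largest
            (greatest largeCore? (x , y , z , tri , z≤n) (length (allFin n)) λ _ (x , y , z , _ , k≤) →
              ≤-trans k≤ (length-filter (T? x y z) (allFin n)))
    where
    -- With an inequality instead of an equation, any stable triple witnesses `LargeCore 0`, as
    -- `greatest` requires.
    LargeCore : ℕ → Set
    LargeCore k = ∃ λ x → ∃ λ y → ∃ λ z → Triangle x y z × k ≤ length (Ts x y z)

    largeCore? : Decidable LargeCore
    largeCore? k = any? λ x → any? λ y → any? λ z → triangle? x y z ×-dec (k ≤? length (Ts x y z))

    from-largest : ∃ (IsGreatest LargeCore) → Goal
    from-largest (k , (a , b , c , tri , k≤) , k-greatest) = NoJoined.Extremal.bounds
      (λ tri uv Tu Tv → no-joined-pair (_ , _ , _ , _ , _ , tri , uv , Tu , Tv)) (T? a b c) maximal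
      (NoJoined.Extremal.base tri id)
      where
      maximal : ∀ {x y z} → Triangle x y z → (∀ {v} → T a b c v → T x y z v) → ∀ {v} → T x y z v → T a b c v
      maximal {x} {y} {z} tri′ T⊆ {v} Tv with T? a b c v
      ... | yes Tv′ = Tv′
      ... | no ¬Tv′ = ⊥-elim (<⇒≱
            (≤-trans (s≤s k≤) (length-filter-< (T? a b c) (T? x y z) (allFin n) T⊆ (∈-allFin v) ¬Tv′ Tv))
            (k-greatest _ (x , y , z , tri′ , ≤-refl)))

-- From forbidden induced subgraphs to conditions on `≁`.

module ForbiddenSubgraphs {n} (G : Graph n) where

  open Graphs G

  -- Distinct vertices of `H` have images related by `~` or by `≁`. Either relation makes the images
  -- distinct, which gives injectivity, and the two exclude each other, which reflects adjacency.
  induced-copy : ∀ {m} (H : Graph m) (f : Fin m → V) → (∀ i j → Adj H i j → f i ~ f j) →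
                 (∀ i j → i ≢ j → ¬ Adj H i j → f i ≁ f j) → ContainsInduced G H
  induced-copy H f edge non-edge = f , injective , λ i j → mk⇔ (edge i j) (reflects i j)
    where
    injective : ∀ {i j} → f i ≡ f j → i ≡ j
    injective {i} {j} fi≡fj with i ≟ j
    ... | yes i≡j = i≡j
    ... | no i≢j with adj? H i j
    ...   | yes ij = ⊥-elim (~⇒≢ (edge i j ij) fi≡fj)
    ...   | no ¬ij = ⊥-elim (proj₁ (non-edge i j i≢j ¬ij) fi≡fj)
    reflects : ∀ i j → f i ~ f j → Adj H i j
    reflects i j fij with i ≟ j
    ... | yes refl = ⊥-elim (irrefl G (f i) fij)
    ... | no i≢j with adj? H i j
    ...   | yes ij = ij
    ...   | no ¬ij = ⊥-elim (≁⇒¬~ (non-edge i j i≢j ¬ij) fij)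

  K₄-free : G IsFreeOf edgeless 4 → K₄-Free
  K₄-free 4K₁-free {a} {b} {c} {d} ab ac ad bc bd cd =
    4K₁-free (induced-copy (edgeless 4) f (λ _ _ ()) λ i j i≢j _ → distinct i j i≢j)
    where
    f : Fin 4 → V
    f 0F = a
    f 1F = b
    f 2F = c
    f 3F = d
    distinct : ∀ i j → i ≢ j → f i ≁ f j
    distinct 0F 0F i≢j = ⊥-elim (i≢j refl)
    distinct 0F 1F _ = ab
    distinct 0F 2F _ = ac
    distinct 0F 3F _ = ad
    distinct 1F 0F _ = ≁-sym ab
    distinct 1F 1F i≢j = ⊥-elim (i≢j refl)
    distinct 1F 2F _ = bc
    distinct 1F 3F _ = bd
    distinct 2F 0F _ = ≁-sym ac
    distinct 2F 1F _ = ≁-sym bc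
    distinct 2F 2F i≢j = ⊥-elim (i≢j refl)
    distinct 2F 3F _ = cd
    distinct 3F 0F _ = ≁-sym ad
    distinct 3F 1F _ = ≁-sym bd
    distinct 3F 2F _ = ≁-sym cd
    distinct 3F 3F i≢j = ⊥-elim (i≢j refl)

  P₃∪P₂-free : G IsFreeOf complement (path 3 ∪ᴳ path 2) → P₃∪P₂-Free
  P₃∪P₂-free free {u} {v} {x} {y} {z} uv xy yz xz (ux , uy , uz) (vx , vy , vz) =
    free (induced-copy (complement H) (λ i → f (splitAt 3 i))
      (λ i j (i≢j , ¬ij) → apart (splitAt 3 i) (splitAt 3 j) (λ eq → i≢j (splitAt-injective i j eq)) ¬ij)
      -- A non-edge of the complement only yields the double negation of an edge of `H`, which
      -- decidability removes.
      (λ i j i≢j ¬ij → close (splitAt 3 i) (splitAt 3 j) (decidable-stable (adj? H i j) λ ¬Hij → ¬ij (i≢j , ¬Hij))))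
    where
    H = path 3 ∪ᴳ path 2
    splitAt-injective : ∀ i j → splitAt 3 {2} i ≡ splitAt 3 j → i ≡ j
    splitAt-injective i j eq = trans (sym (join-splitAt 3 2 i)) (trans (cong (join 3 2) eq) (join-splitAt 3 2 j))

    f : Fin 3 ⊎ Fin 2 → V
    f (inj₁ 0F) = x
    f (inj₁ 1F) = y
    f (inj₁ 2F) = z
    f (inj₂ 0F) = u
    f (inj₂ 1F) = v

    Edge : Fin 3 ⊎ Fin 2 → Fin 3 ⊎ Fin 2 → Set
    Edge = ⊎ᴾ.Pointwise (Adj (path 3)) (Adj (path 2))

    close₃ : ∀ i j → suc (toℕ i) ≡ toℕ j → f (inj₁ i) ≁ f (inj₁ j)
    close₃ 0F 1F _ = xy
    close₃ 1F 2F _ = yz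
    close₃ 0F 0F ()
    close₃ 0F 2F ()
    close₃ 1F 0F ()
    close₃ 1F 1F ()
    close₃ 2F 0F ()
    close₃ 2F 1F ()
    close₃ 2F 2F ()

    close₂ : ∀ i j → suc (toℕ i) ≡ toℕ j → f (inj₂ i) ≁ f (inj₂ j)
    close₂ 0F 1F _ = uv
    close₂ 0F 0F ()
    close₂ 1F 0F ()
    close₂ 1F 1F ()

    close : ∀ s t → Edge s t → f s ≁ f t
    close _ _ (⊎ᴾ.inj₁ (inj₁ ij)) = close₃ _ _ ij
    close _ _ (⊎ᴾ.inj₁ (inj₂ ji)) = ≁-sym (close₃ _ _ ji)
    close _ _ (⊎ᴾ.inj₂ (inj₁ ij)) = close₂ _ _ ij
    close _ _ (⊎ᴾ.inj₂ (inj₂ ji)) = ≁-sym (close₂ _ _ ji)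

    across : ∀ i j → f (inj₂ i) ~ f (inj₁ j)
    across 0F 0F = ux
    across 0F 1F = uy
    across 0F 2F = uz
    across 1F 0F = vx
    across 1F 1F = vy
    across 1F 2F = vz

    apart : ∀ s t → s ≢ t → ¬ Edge s t → f s ~ f t
    apart (inj₁ i) (inj₂ j) _ _ = ~-sym (across j i)
    apart (inj₂ i) (inj₁ j) _ _ = across i j
    apart (inj₁ 0F) (inj₁ 2F) _ _ = xz
    apart (inj₁ 2F) (inj₁ 0F) _ _ = ~-sym xz
    apart (inj₁ 0F) (inj₁ 1F) _ ¬e = ⊥-elim (¬e (⊎ᴾ.inj₁ (inj₁ refl)))
    apart (inj₁ 1F) (inj₁ 0F) _ ¬e = ⊥-elim (¬e (⊎ᴾ.inj₁ (inj₂ refl)))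
    apart (inj₁ 1F) (inj₁ 2F) _ ¬e = ⊥-elim (¬e (⊎ᴾ.inj₁ (inj₁ refl)))
    apart (inj₁ 2F) (inj₁ 1F) _ ¬e = ⊥-elim (¬e (⊎ᴾ.inj₁ (inj₂ refl)))
    apart (inj₂ 0F) (inj₂ 1F) _ ¬e = ⊥-elim (¬e (⊎ᴾ.inj₂ (inj₁ refl)))
    apart (inj₂ 1F) (inj₂ 0F) _ ¬e = ⊥-elim (¬e (⊎ᴾ.inj₂ (inj₂ refl)))
    apart (inj₁ 0F) (inj₁ 0F) s≢t _ = ⊥-elim (s≢t refl)
    apart (inj₁ 1F) (inj₁ 1F) s≢t _ = ⊥-elim (s≢t refl)
    apart (inj₁ 2F) (inj₁ 2F) s≢t _ = ⊥-elim (s≢t refl)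
    apart (inj₂ 0F) (inj₂ 0F) s≢t _ = ⊥-elim (s≢t refl)
    apart (inj₂ 1F) (inj₂ 1F) s≢t _ = ⊥-elim (s≢t refl)

theorem1p4 : ∀ (n : ℕ) (G : Graph n) →
    G IsFreeOf edgeless 4 →
    G IsFreeOf complement (path 3 ∪ᴳ path 2) →
    n ≤ 7 * ω G × χ G ≤ 4 * ω G
theorem1p4 n G 4K₁-free P-free = FreeGraphs.goal G (K₄-free 4K₁-free) (P₃∪P₂-free P-free)
  where
  open ForbiddenSubgraphs G
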